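{- Let $k\ge 3$. Let $G'$ be a $k$-colorable connected graph of order $n$, diameter $D$ and minimum degree at least $\delta$. Then there is a connected graph $G$ of order $n$, diameter $D$ and minimum degree at least $\delta$, together with a proper $k$-coloring of $G$ and a vertex $x$ of eccentricity $D$, such that, writing $L_j$ for the set of vertices at distance $j$ from $x$ ($0\le j\le D$) and $c(j)$ for the number of colors used on $L_j$, the following hold for every $i$ with $0\le i\le D-1$: (i) if $c(i)=1$, then $c(i+1)\le k-1$; (ii) the number of colors used on $L_i\cup L_{i+1}$ is $\min(k,c(i)+c(i+1))$; in particular, if $c(i)+c(i+1)\le k$ then $L_i$ and $L_{i+1}$ share no color; (iii) if $c(i)=k$, then $i\ge 2$ and $c(i+1)\ge 2$; (iv) if $|L_i|>c(i)$ (i.e. $L_i$ contains two vertices of the same color), then $i>0$ and $c(i)+\max\bigl(c(i-1),c(i+1)\bigr)\ge k$.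
   Context: The eccentricity of a vertex is the maximum of its distances to the other vertices; $L_0,\dots,L_D$ are called layers. -}

module Defs where

open import Data.Nat using (ℕ; zero; suc; _+_; _≤_; _<_; _∸_; _⊔_; _⊓_; _≡ᵇ_)
open import Data.Fin using (Fin; zero; suc)
open import Data.Bool using (Bool; true; false; _∧_; _∨_; if_then_else_)
open import Data.Product using (Σ; ∃; _×_; _,_)
open import Relation.Binary.PropositionalEquality using (_≡_; _≢_)
open import Relation.Nullary.Decidable using (⌊_⌋)
import Data.Fin as F

anyF : ∀ {m} → (Fin m → Bool) → Bool
anyF {zero}  f = false
anyF {suc m} f = f zero ∨ anyF (λ i → f (suc i))

countF : ∀ {m} → (Fin m → Bool) → ℕ
countF {zero}  f = 0
countF {suc m} f = (if f zero then 1 else 0) + countF (λ i → f (suc i))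

maxF : ∀ {m} → (Fin m → ℕ) → ℕ
maxF {zero}  f = 0
maxF {suc m} f = f zero ⊔ maxF (λ i → f (suc i))

record Graph (n : ℕ) : Set where
  field
    adj    : Fin n → Fin n → Bool
    sym    : ∀ u v → adj u v ≡ adj v u
    irrefl : ∀ v → adj v v ≡ false
open Graph public

module _ {n : ℕ} (G : Graph n) where

  reach : ℕ → Fin n → Fin n → Bool
  reach zero    u v = ⌊ u F.≟ v ⌋
  reach (suc ℓ) u v = reach ℓ u v ∨ anyF (λ w → reach ℓ u w ∧ adj G w v)

  Connected : Set
  Connected = ∀ u v → ∃ λ ℓ → reach ℓ u v ≡ true

  -- graph distance: least ℓ with reach ℓ u v (searched up to n; in a
  -- connected graph of order n the distance is always < n, so the search
  -- always succeeds there)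
  private
    search : Fin n → Fin n → ℕ → ℕ → ℕ
    search u v ℓ zero       = ℓ
    search u v ℓ (suc fuel) = if reach ℓ u v then ℓ else search u v (suc ℓ) fuel

  dist : Fin n → Fin n → ℕ
  dist u v = search u v 0 n

  degree : Fin n → ℕ
  degree v = countF (adj G v)

  MinDegreeAtLeast : ℕ → Set
  MinDegreeAtLeast δ = ∀ v → δ ≤ degree v

  eccentricity : Fin n → ℕ
  eccentricity x = maxF (dist x)

  diameter : ℕ
  diameter = maxF eccentricity

  ProperColoring : (k : ℕ) → (Fin n → Fin k) → Set
  ProperColoring k col = ∀ u v → adj G u v ≡ true → col u ≢ col v

  Colorable : ℕ → Set
  Colorable k = Σ (Fin n → Fin k) (ProperColoring k)

  inLayer : Fin n → ℕ → Fin n → Bool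
  inLayer x j v = dist x v ≡ᵇ j

  layerSize : Fin n → ℕ → ℕ
  layerSize x j = countF (inLayer x j)

  usedOn : ∀ {k} → (Fin n → Fin k) → (Fin n → Bool) → Fin k → Bool
  usedOn col P a = anyF (λ v → P v ∧ ⌊ col v F.≟ a ⌋)

  colorsOn : ∀ {k} → (Fin n → Fin k) → (Fin n → Bool) → ℕ
  colorsOn col P = countF (usedOn col P)

  cLayer : ∀ {k} → (Fin n → Fin k) → Fin n → ℕ → ℕ
  cLayer col x j = colorsOn col (inLayer x j)

  cTwoLayers : ∀ {k} → (Fin n → Fin k) → Fin n → ℕ → ℕ
  cTwoLayers col x i = colorsOn col (λ v → inLayer x i v ∨ inLayer x (suc i) v)

  LayerConditions : (k : ℕ) → (Fin n → Fin k) → Fin n → ℕ → Set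
  LayerConditions k col x D = ∀ i → i < D →
      let c = cLayer col x in
      (c i ≡ 1 → c (suc i) ≤ k ∸ 1)
    ×
      (cTwoLayers col x i ≡ k ⊓ (c i + c (suc i)))
    × (c i + c (suc i) ≤ k → ∀ a →
         usedOn col (inLayer x i) a ≡ true → usedOn col (inLayer x (suc i)) a ≡ false)
    ×
      (c i ≡ k → 2 ≤ i × 2 ≤ c (suc i))
    ×
      (c i < layerSize x i → 0 < i × k ≤ c i + (c (i ∸ 1) ⊔ c (suc i)))

{-# OPTIONS --safe #-}

-- Only the layers (distances from x) and the colouring of G matter: joining all differently
-- coloured vertices in equal or consecutive layers keeps the layers, does not lower degrees, and
-- keeps the diameter at D when D ≥ 2 (for D ≤ 1 the given graph already works).
--
-- Condition (iii) is established from the last layer downwards.  Suppose L_i has all colours and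
-- L_{i+1} only the colour a; then i ≥ 2.  Moving the class of a in L_i to L_{i-1} loses no edges
-- and is possible unless L_{i-2} is monochromatic in a as well.  In that case, if L_{i-1} lacks a
-- colour c ≠ a, exchanging a and c on L_0, …, L_{i-2} makes the move possible.  Otherwise L_{i-1}
-- and L_i both contain every colour other than a, so a vertex of colour d ≠ a in L_{i-1} ∪ L_i has
-- enough neighbours within L_{i-1} ∪ L_i together with L_{i-2}, and also with L_{i+1} instead.
-- Hence colours c ∈ L_{i-1} and b ∈ L_i may be exchanged vertex by vertex, until either L_{i-1}
-- has no c or L_i has no b; in the latter case exchanging a and b on L_0, …, L_i removes a from L_i.
--
-- Conditions (ii) and (iv) then hold for a colouring with the most edges.  If L_i and L_{i+1} share
-- a and both lack b, exchanging a and b on L_0, …, L_i gains an edge.  If L_i repeats a colour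
-- while b is missing on L_{i-1} ∪ L_i and b′ on L_i ∪ L_{i+1}, exchanging b and b′ on L_0, …, L_i
-- makes b′ absent from all three layers, and giving it to a repeated vertex gains an edge.
module Submission where

open import Defs hiding (sym)
open import Data.Bool using (Bool; true; false; _∧_; _∨_; if_then_else_)
import Data.Bool as Bool
open import Data.Bool.Properties using (T-≡)
open import Data.Empty using (⊥; ⊥-elim)
open import Data.Fin using (Fin; zero; suc)
import Data.Fin as F
import Data.Fin.Properties as F
open import Data.Fin.Permutation.Components using (transpose)
open import Data.Nat
open import Data.Nat.Properties
open import Data.Product using (Σ; ∃; ∃₂; _×_; _,_; proj₁; proj₂)
open import Data.Sum using (_⊎_; inj₁; inj₂; [_,_]′)
open import Function using (_∘_; id; case_of_)
open import Function.Bundles using (Equivalence)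
open import Relation.Binary using (tri<; tri≈; tri>)
open import Relation.Binary.PropositionalEquality
open import Relation.Nullary using (¬_; Dec; yes; no; contradiction)
open import Relation.Nullary.Decidable using (⌊_⌋; _×-dec_; _⊎-dec_; ¬?; dec-true; dec-false)
open import Tactic.Cong using (cong!)

-- Booleans, counts and maxima over finite index sets.

⌊⌋⇒ : ∀ {P : Set} (P? : Dec P) → ⌊ P? ⌋ ≡ true → P
⌊⌋⇒ (yes p) _ = p

⇒⌊⌋ : ∀ {P : Set} (P? : Dec P) → P → ⌊ P? ⌋ ≡ true
⇒⌊⌋ (yes _) _ = refl
⇒⌊⌋ (no ¬p) p = contradiction p ¬p

¬⇒⌊⌋ : ∀ {P : Set} (P? : Dec P) → ¬ P → ⌊ P? ⌋ ≡ false
¬⇒⌊⌋ (yes p) ¬p = contradiction p ¬p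
¬⇒⌊⌋ (no _) _ = refl

∧⇒ : ∀ {a b} → a ∧ b ≡ true → a ≡ true × b ≡ true
∧⇒ {true} {true} _ = refl , refl

∨⇒ : ∀ {a b} → a ∨ b ≡ true → a ≡ true ⊎ b ≡ true
∨⇒ {true} _ = inj₁ refl
∨⇒ {false} b = inj₂ b

⇒∨ : ∀ {a b} → a ≡ true ⊎ b ≡ true → a ∨ b ≡ true
⇒∨ {true} _ = refl
⇒∨ {false} (inj₂ b) = b

false≢true : ∀ {b} → b ≡ false → b ≢ true
false≢true refl ()

anyF⇒ : ∀ {m} {f : Fin m → Bool} → anyF f ≡ true → ∃ λ v → f v ≡ true
anyF⇒ {suc m} {f} e with ∨⇒ {f zero} e
... | inj₁ p = zero , p
... | inj₂ p with anyF⇒ {m} p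
...   | v , q = suc v , q

⇒anyF : ∀ {m} {f : Fin m → Bool} v → f v ≡ true → anyF f ≡ true
⇒anyF {suc m} zero p = ⇒∨ (inj₁ p)
⇒anyF {suc m} {f} (suc v) p = ⇒∨ {f zero} (inj₂ (⇒anyF v p))

_⊆_ : ∀ {m} → (Fin m → Bool) → (Fin m → Bool) → Set
f ⊆ g = ∀ v → f v ≡ true → g v ≡ true

indicator : Bool → ℕ
indicator b = if b then 1 else 0

countF-cong : ∀ {m} {f g : Fin m → Bool} → (∀ v → f v ≡ g v) → countF f ≡ countF g
countF-cong {zero} _ = refl
countF-cong {suc m} e = cong₂ (λ b c → indicator b + c) (e zero) (countF-cong (e ∘ suc))

countF-false : ∀ m → countF {m} (λ _ → false) ≡ 0
countF-false zero = refl
countF-false (suc m) = countF-false m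

countF-true : ∀ m → countF {m} (λ _ → true) ≡ m
countF-true zero = refl
countF-true (suc m) = cong suc (countF-true m)

indicator-mono : ∀ {a b} → (a ≡ true → b ≡ true) → indicator a ≤ indicator b
indicator-mono {false} _ = z≤n
indicator-mono {true} h rewrite h refl = ≤-refl

countF-mono : ∀ {m} {f g : Fin m → Bool} → f ⊆ g → countF f ≤ countF g
countF-mono {zero} _ = z≤n
countF-mono {suc m} h = +-mono-≤ (indicator-mono (h zero)) (countF-mono (h ∘ suc))

countF-mono-< : ∀ {m} {f g : Fin m → Bool} → f ⊆ g →
  ∀ v → f v ≡ false → g v ≡ true → countF f < countF g
countF-mono-< {suc m} h zero fv gv rewrite fv | gv = s≤s (countF-mono (h ∘ suc))
countF-mono-< {suc m} h (suc v) fv gv =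
  +-mono-≤-< (indicator-mono (h zero)) (countF-mono-< (h ∘ suc) v fv gv)

countF-∨ : ∀ {m} (f g : Fin m → Bool) → countF (λ v → f v ∨ g v) ≤ countF f + countF g
countF-∨ {zero} f g = z≤n
countF-∨ {suc m} f g = begin
  indicator (f zero ∨ g zero) + countF (λ v → f (suc v) ∨ g (suc v))
    ≤⟨ +-mono-≤ (head (f zero)) (countF-∨ (f ∘ suc) (g ∘ suc)) ⟩
  (indicator (f zero) + indicator (g zero)) + (countF (f ∘ suc) + countF (g ∘ suc))
    ≡⟨ interchange (indicator (f zero)) _ _ _ ⟩
  (indicator (f zero) + countF (f ∘ suc)) + (indicator (g zero) + countF (g ∘ suc)) ∎
  where
  open ≤-Reasoning
  open import Algebra.Properties.CommutativeSemigroup +-commutativeSemigroup using (interchange)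
  head : ∀ a → indicator (a ∨ g zero) ≤ indicator a + indicator (g zero)
  head false = ≤-refl
  head true = s≤s z≤n

countF-cover : ∀ {m} {f g h : Fin m → Bool} → (∀ v → h v ≡ true → f v ≡ true ⊎ g v ≡ true) →
  countF h ≤ countF f + countF g
countF-cover {f = f} {g} e = ≤-trans (countF-mono (λ v → ⇒∨ {f v} ∘ e v)) (countF-∨ f g)

countF-disjoint : ∀ {m} {f g h : Fin m → Bool} → (∀ v → f v ≡ true → g v ≡ true → ⊥) →
  f ⊆ h → g ⊆ h → countF f + countF g ≤ countF h
countF-disjoint {zero} _ _ _ = z≤n
countF-disjoint {suc m} {f} {g} {h} d fh gh = begin
  (indicator (f zero) + countF (f ∘ suc)) + (indicator (g zero) + countF (g ∘ suc))
    ≡⟨ interchange (indicator (f zero)) _ _ _ ⟩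
  (indicator (f zero) + indicator (g zero)) + (countF (f ∘ suc) + countF (g ∘ suc))
    ≤⟨ +-mono-≤ (head _ _ (d zero) (fh zero) (gh zero)) (countF-disjoint (d ∘ suc) (fh ∘ suc) (gh ∘ suc)) ⟩
  indicator (h zero) + countF (h ∘ suc) ∎
  where
  open ≤-Reasoning
  open import Algebra.Properties.CommutativeSemigroup +-commutativeSemigroup using (interchange)
  head : ∀ a b {c} → (a ≡ true → b ≡ true → ⊥) → (a ≡ true → c ≡ true) → (b ≡ true → c ≡ true) →
    indicator a + indicator b ≤ indicator c
  head false b _ _ bc = indicator-mono bc
  head true true d _ _ = ⊥-elim (d refl refl)
  head true false _ ac _ rewrite ac refl = ≤-refl

countF-≤ : ∀ {m} (f : Fin m → Bool) → countF f ≤ m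
countF-≤ {m} f = subst (countF f ≤_) (countF-true m) (countF-mono {f = f} (λ _ _ → refl))

countF-all : ∀ {m} {f : Fin m → Bool} → (∀ v → f v ≡ true) → countF f ≡ m
countF-all {m} {f} h = trans (countF-cong {f = f} {λ _ → true} h) (countF-true m)

countF-<-full : ∀ {m} {f : Fin m → Bool} v → f v ≡ false → countF f < m
countF-<-full {m} {f} v e =
  subst (countF f <_) (countF-true m) (countF-mono-< {f = f} (λ _ _ → refl) v e refl)

countF-full : ∀ {m} {f : Fin m → Bool} → countF f ≡ m → ∀ v → f v ≡ true
countF-full {f = f} e v with f v in fv
... | true = refl
... | false = contradiction e (<⇒≢ (countF-<-full v fv))

countF-positive : ∀ {m} {f : Fin m → Bool} v → f v ≡ true → 0 < countF f
countF-positive {m} {f} v e =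
  subst (_< countF f) (countF-false m) (countF-mono-< {g = f} (λ _ ()) v refl e)

without : ∀ {m} → (Fin m → Bool) → Fin m → Fin m → Bool
without f a v = f v ∧ ⌊ ¬? (v F.≟ a) ⌋

without-≢ : ∀ {m} (f : Fin m → Bool) a v → f v ≡ true → v ≢ a → without f a v ≡ true
without-≢ f a v e v≢a rewrite e = ⇒⌊⌋ (¬? (v F.≟ a)) v≢a

countF-without : ∀ {m} (f : Fin m → Bool) a → f a ≡ true → countF (without f a) < countF f
countF-without f a e = countF-mono-< (λ v → proj₁ ∘ ∧⇒) a lacks e
  where
  lacks : without f a a ≡ false
  lacks rewrite e = ¬⇒⌊⌋ (¬? (a F.≟ a)) (λ a≢a → a≢a refl)

-- Induction on `m`: when `zero` is counted, its image is removed from `g`, and injectivity keeps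
-- the images of the other elements off it.
countF-image : ∀ {m p} (f : Fin m → Bool) (g : Fin p → Bool) (h : Fin m → Fin p) →
  (∀ {u v} → f u ≡ true → f v ≡ true → h u ≡ h v → u ≡ v) →
  (∀ v → f v ≡ true → g (h v) ≡ true) → countF f ≤ countF g
countF-image {zero} f g h inj fg = z≤n
countF-image {suc m} f g h inj fg with f zero in f0
... | false = countF-image (f ∘ suc) g (h ∘ suc)
                (λ fu fv e → F.suc-injective (inj fu fv e)) (fg ∘ suc)
... | true = ≤-trans (s≤s tail) (countF-without g (h zero) (fg zero f0))
  where
  tail : countF (f ∘ suc) ≤ countF (without g (h zero))
  tail = countF-image (f ∘ suc) (without g (h zero)) (h ∘ suc)
    (λ fu fv e → F.suc-injective (inj fu fv e))
    (λ v fv → without-≢ g (h zero) (h (suc v)) (fg (suc v) fv) λ e → case inj fv f0 e of λ ())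

countF-two : ∀ {m} {f : Fin m → Bool} {a b} → f a ≡ true → f b ≡ true → a ≢ b → 2 ≤ countF f
countF-two {f = f} {a} {b} fa fb a≢b =
  <-≤-trans (s≤s (countF-positive b (without-≢ f a b fb (a≢b ∘ sym)))) (countF-without f a fa)

maxF-upper : ∀ {m} (f : Fin m → ℕ) v → f v ≤ maxF f
maxF-upper f zero = m≤m⊔n _ _
maxF-upper f (suc v) = ≤-trans (maxF-upper (f ∘ suc) v) (m≤n⊔m (f zero) _)

maxF-least : ∀ {m} (f : Fin m → ℕ) {b} → (∀ v → f v ≤ b) → maxF f ≤ b
maxF-least {zero} f h = z≤n
maxF-least {suc m} f h = ⊔-lub (h zero) (maxF-least (f ∘ suc) (h ∘ suc))

maxF-attained : ∀ {m} (f : Fin (suc m) → ℕ) → ∃ λ v → f v ≡ maxF f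
maxF-attained {zero} f = zero , sym (⊔-identityʳ _)
maxF-attained {suc m} f with ≤-total (maxF (f ∘ suc)) (f zero)
... | inj₁ le = zero , sym (m≥n⇒m⊔n≡m le)
... | inj₂ ge with maxF-attained (f ∘ suc)
...   | v , e = suc v , trans e (sym (m≤n⇒m⊔n≡n ge))

-- The search loop behind dist is private to Defs, so induction on its fuel needs a name for it.
-- Unification supplies one.  Abstracting the start in Is (dist G u v) exhibits the loop at
-- an arbitrary start, once with fuel n and once, after one unfolding, with fuel n - 1; the
-- anti-unification of these two terms by cong! then abstracts the fuel as well.
module DistanceSearch where

  data Is (x : ℕ) : Set where
    is : Is x

  data IsFun (f : ℕ → ℕ) : Set where
    isFun : IsFun f

  data IsProof {x y : ℕ} (e : x ≡ y) : Set where
    isProof : IsProof e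

  mutual
    fullFuel : ∀ {n} (G : Graph n) (u v : Fin n) (ℓ : ℕ) → Is _
    fullFuel G u v ℓ = is

    fullFuel-solution : ∀ {n} (G : Graph n) (u v : Fin n) → Is (dist G u v)
    fullFuel-solution G u v with 0
    ... | ℓ = fullFuel G u v ℓ

  mutual
    oneLess : ∀ {m} (G : Graph (suc m)) (u v : Fin (suc m)) (ℓ : ℕ) → Is _
    oneLess G u v ℓ = is

    oneLess-solution : ∀ {m} (G : Graph (suc m)) (u v : Fin (suc m)) → Is (dist G u v)
    oneLess-solution G u v with 1
    ... | ℓ = else-branch {b = ⌊ u F.≟ v ⌋} (oneLess G u v ℓ)
      where
      else-branch : ∀ {b x y} → Is y → Is (if b then x else y)
      else-branch _ = is

  equation : ∀ {x y} → Is x → Is y → x ≡ y → x ≡ y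
  equation _ _ e = e

  fuel-cong : ∀ {m} (G : Graph (suc m)) (u v : Fin (suc m)) (ℓ : ℕ) → suc m ≡ m → _
  fuel-cong G u v ℓ e = equation (fullFuel G u v ℓ) (oneLess G u v ℓ) (cong! e)

  congruence : ∀ {x y} {f : ℕ → ℕ} (e : x ≡ y) → IsFun f → IsProof (cong f e)
  congruence _ _ = isProof

  mutual
    anyFuel : ∀ {m} (G : Graph (suc m)) (u v : Fin (suc m)) (ℓ : ℕ) → IsFun _
    anyFuel G u v ℓ = isFun

    anyFuel-solution : ∀ {m} (G : Graph (suc m)) (u v : Fin (suc m)) (ℓ : ℕ) (e : suc m ≡ m) →
      IsProof (fuel-cong G u v ℓ e)
    anyFuel-solution G u v ℓ e = congruence e (anyFuel G u v ℓ)

  function : ∀ {f} → IsFun f → ℕ → ℕ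
  function {f} _ = f

  searchFrom : ∀ {m} → Graph (suc m) → Fin (suc m) → Fin (suc m) → ℕ → ℕ → ℕ
  searchFrom G u v ℓ = function (anyFuel G u v ℓ)

  searchFrom-≤ : ∀ {m} (G : Graph (suc m)) {u v d} → reach G d u v ≡ true →
    ∀ f {ℓ} → ℓ ≤ d → searchFrom G u v ℓ f ≤ d
  searchFrom-≤ G r zero ℓ≤d = ℓ≤d
  searchFrom-≤ G {u} {v} r (suc f) {ℓ} ℓ≤d with reach G ℓ u v in e
  ... | true = ℓ≤d
  ... | false = searchFrom-≤ G r f (≤∧≢⇒< ℓ≤d λ { refl → false≢true e r })

  -- The test fails at every `ℓ < d`, so the search can stop early only for want of fuel, and
  -- `d ≤ ℓ + f` provides enough of it.
  searchFrom-≥ : ∀ {m} (G : Graph (suc m)) {u v d} → (∀ j → j < d → reach G j u v ≡ false) →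
    ∀ f {ℓ} → ℓ ≤ d → d ≤ ℓ + f → d ≤ searchFrom G u v ℓ f
  searchFrom-≥ G r zero {ℓ} _ d≤ = ≤-trans d≤ (≤-reflexive (+-identityʳ ℓ))
  searchFrom-≥ G {u} {v} r (suc f) {ℓ} ℓ≤d d≤ with reach G ℓ u v in e
  ... | true = ≮⇒≥ λ ℓ<d → false≢true (r ℓ ℓ<d) e
  ... | false with m≤n⇒m<n∨m≡n ℓ≤d
  ...   | inj₁ ℓ<d = searchFrom-≥ G r f ℓ<d (≤-trans d≤ (≤-reflexive (+-suc ℓ f)))
  -- At `ℓ = d` the test has failed, and nothing is assumed about later ones; the search never
  -- returns less than its start.
  ...   | inj₂ refl = ≤-trans (n≤1+n _) (searchFrom-start f)
    where
    searchFrom-start : ∀ f {ℓ} → ℓ ≤ searchFrom G u v ℓ f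
    searchFrom-start zero = ≤-refl
    searchFrom-start (suc f) {ℓ} with reach G ℓ u v
    ... | true = ≤-refl
    ... | false = ≤-trans (n≤1+n ℓ) (searchFrom-start f)

-- Distance as the least length of a walk.

IsDistance : ∀ {n} → Graph n → Fin n → Fin n → ℕ → Set
IsDistance G u v d = reach G d u v ≡ true × (∀ j → j < d → reach G j u v ≡ false)

module _ {n} (G : Graph n) where

  reach-step : ∀ {j u w v} → reach G j u w ≡ true → adj G w v ≡ true → reach G (suc j) u v ≡ true
  reach-step {j} {u} {w} {v} r a = ⇒∨ {reach G j u v} (inj₂ (⇒anyF w (step r a)))
    where
    step : ∀ {b c} → b ≡ true → c ≡ true → b ∧ c ≡ true
    step refl refl = refl

  reach-suc⇒ : ∀ {j u v} → reach G (suc j) u v ≡ true →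
    reach G j u v ≡ true ⊎ ∃ λ w → reach G j u w ≡ true × adj G w v ≡ true
  reach-suc⇒ {j} {u} {v} r with ∨⇒ {reach G j u v} r
  ... | inj₁ p = inj₁ p
  ... | inj₂ p with anyF⇒ p
  ...   | w , q = inj₂ (w , ∧⇒ q)

  reach-weaken : ∀ {i j u v} → i ≤ j → reach G i u v ≡ true → reach G j u v ≡ true
  reach-weaken i≤j r = go (≤⇒≤′ i≤j) r
    where
    go : ∀ {i j u v} → i ≤′ j → reach G i u v ≡ true → reach G j u v ≡ true
    go ≤′-refl r = r
    go (≤′-step p) r = ⇒∨ (inj₁ (go p r))

  reach-refl : ∀ {u} → reach G 0 u u ≡ true
  reach-refl {u} = ⇒⌊⌋ (u F.≟ u) refl

  -- `reach` prolongs walks at their end; symmetry requires prolonging them at their start.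
  reach-cons : ∀ j {u w v} → adj G u w ≡ true → reach G j w v ≡ true → reach G (suc j) u v ≡ true
  reach-cons zero {u} {w} {v} a r with refl ← ⌊⌋⇒ (w F.≟ v) r = reach-step {0} reach-refl a
  reach-cons (suc j) a r with reach-suc⇒ {j} r
  ... | inj₁ p = reach-weaken (n≤1+n (suc j)) (reach-cons j a p)
  ... | inj₂ (x , p , b) = reach-step {suc j} (reach-cons j a p) b

  reach-sym : ∀ j {u v} → reach G j u v ≡ true → reach G j v u ≡ true
  reach-sym zero {u} {v} r with refl ← ⌊⌋⇒ (u F.≟ v) r = r
  reach-sym (suc j) r with reach-suc⇒ {j} r
  ... | inj₁ p = reach-weaken (n≤1+n j) (reach-sym j p)
  ... | inj₂ (x , p , b) = reach-cons j (trans (Graph.sym G _ _) b) (reach-sym j p)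

  isDistance-unique : ∀ {u v c d} → IsDistance G u v c → IsDistance G u v d → c ≡ d
  isDistance-unique {c = c} {d} (rc , fc) (rd , fd) with <-cmp c d
  ... | tri< c<d _ _ = contradiction rc (false≢true (fd c c<d))
  ... | tri≈ _ e _ = e
  ... | tri> _ _ d<c = contradiction rd (false≢true (fc d d<c))

  -- A shorter walk to `w` would extend along the last edge to a walk to `v` of length at most `d`.
  isDistance-pred : ∀ {u v d} → IsDistance G u v (suc d) →
    ∃ λ w → IsDistance G u w d × adj G w v ≡ true
  isDistance-pred {u} {d = d} (r , f) with reach-suc⇒ {d} r
  ... | inj₁ p = contradiction p (false≢true (f d ≤-refl))
  ... | inj₂ (w , p , a) = w , (p , below) , a
    where
    below : ∀ j → j < d → reach G j u w ≡ false
    below j j<d with reach G j u w in e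
    ... | false = refl
    ... | true = contradiction (reach-step {j} e a) (false≢true (f (suc j) (s≤s j<d)))

  isDistance-below : ∀ {u v d j} → j ≤ d → IsDistance G u v d → ∃ λ w → IsDistance G u w j
  isDistance-below j≤d h = go (≤⇒≤′ j≤d) h
    where
    go : ∀ {u v d j} → j ≤′ d → IsDistance G u v d → ∃ λ w → IsDistance G u w j
    go ≤′-refl h = _ , h
    go (≤′-step p) h = go p (proj₁ (proj₂ (isDistance-pred h)))

  -- A geodesic of length d visits d + 1 distinct vertices.
  isDistance-< : ∀ {u v d} → IsDistance G u v d → d < n
  isDistance-< {u} {v} {d} h = ≰⇒> λ n≤d → collision (F.pigeonhole (s≤s n≤d) (proj₁ ∘ at))
    where
    at : (i : Fin (suc d)) → ∃ λ w → IsDistance G u w (F.toℕ i)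
    at i = isDistance-below (F.toℕ≤pred[n] i) h
    collision : (∃₂ λ i j → i F.< j × proj₁ (at i) ≡ proj₁ (at j)) → ⊥
    collision (i , j , i<j , e) = <⇒≢ i<j
      (isDistance-unique (proj₂ (at i)) (subst (λ w → IsDistance G u w _) (sym e) (proj₂ (at j))))

  reach⇒isDistance : ∀ ℓ {u v} → reach G ℓ u v ≡ true → ∃ λ d → IsDistance G u v d
  reach⇒isDistance zero r = 0 , r , λ _ ()
  reach⇒isDistance (suc ℓ) {u} {v} r with reach G ℓ u v in e
  ... | true = reach⇒isDistance ℓ e
  ... | false = suc ℓ , subst (λ b → b ∨ anyF (λ w → reach G ℓ u w ∧ adj G w v) ≡ true) (sym e) r , below
    where
    below : ∀ j → j < suc ℓ → reach G j u v ≡ false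
    below j (s≤s j≤ℓ) with reach G j u v in f
    ... | false = refl
    ... | true = contradiction (reach-weaken j≤ℓ f) (false≢true e)

dist-≤ : ∀ {n} (G : Graph n) {u v d} → reach G d u v ≡ true → dist G u v ≤ d
dist-≤ {suc m} G r = DistanceSearch.searchFrom-≤ G r (suc m) z≤n

isDistance⇒dist : ∀ {n} (G : Graph n) {u v d} → IsDistance G u v d → dist G u v ≡ d
isDistance⇒dist {suc m} G h@(r , below) = ≤-antisym (dist-≤ G r)
  (DistanceSearch.searchFrom-≥ G below (suc m) z≤n (<⇒≤ (isDistance-< G h)))

dist-isDistance : ∀ {n} {G : Graph n} → Connected G → ∀ u v → IsDistance G u v (dist G u v)
dist-isDistance {G = G} conn u v with conn u v
... | ℓ , r with reach⇒isDistance G ℓ r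
...   | d , h = subst (IsDistance G u v) (sym (isDistance⇒dist G h)) h

⌊⌋-cong : ∀ {P Q : Set} (P? : Dec P) (Q? : Dec Q) → (P → Q) → (Q → P) → ⌊ P? ⌋ ≡ ⌊ Q? ⌋
⌊⌋-cong (yes p) Q? f g = sym (⇒⌊⌋ Q? (f p))
⌊⌋-cong (no ¬p) Q? f g = sym (¬⇒⌊⌋ Q? (¬p ∘ g))

-- Transpositions and the choice of further colours.

module _ {m} (a b : Fin m) where

  transpose-left : transpose a b a ≡ b
  transpose-left rewrite dec-true (a F.≟ a) refl = refl

  transpose-right : transpose a b b ≡ a
  transpose-right with b F.≟ a
  ... | yes b≡a = b≡a
  ... | no _ rewrite dec-true (b F.≟ b) refl = refl

  transpose-fixed : ∀ {c} → c ≢ a → c ≢ b → transpose a b c ≡ c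
  transpose-fixed {c} c≢a c≢b rewrite dec-false (c F.≟ a) c≢a | dec-false (c F.≟ b) c≢b = refl

  transpose-involutive : ∀ c → transpose a b (transpose a b c) ≡ c
  transpose-involutive c = go (c F.≟ a) (c F.≟ b)
    where
    go : Dec (c ≡ a) → Dec (c ≡ b) → transpose a b (transpose a b c) ≡ c
    go (yes refl) _ = trans (cong (transpose a b) transpose-left) transpose-right
    go (no _) (yes refl) = trans (cong (transpose a b) transpose-right) transpose-left
    go (no c≢a) (no c≢b) = trans (cong (transpose a b) fixed) fixed
      where
      fixed : transpose a b c ≡ c
      fixed = transpose-fixed c≢a c≢b

  transpose-injective : ∀ {c d} → transpose a b c ≡ transpose a b d → c ≡ d
  transpose-injective {c} {d} e =
    trans (sym (transpose-involutive c)) (trans (cong (transpose a b) e) (transpose-involutive d))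

  transpose-flip : ∀ {c d} → transpose a b c ≡ d → c ≡ transpose a b d
  transpose-flip {c} e = trans (sym (transpose-involutive c)) (cong (transpose a b) e)

fresh : ∀ {k} → 3 ≤ k → (a b : Fin k) → ∃ λ c → c ≢ a × c ≢ b
fresh (s≤s (s≤s (s≤s _))) a b with F.zero F.≟ a | F.zero F.≟ b
... | no p | no q = zero , p , q
... | yes refl | _ with F.suc zero F.≟ b
...   | no q = suc zero , (λ ()) , q
...   | yes refl = suc (suc zero) , (λ ()) , λ ()
fresh (s≤s (s≤s (s≤s _))) a b | no _ | yes refl with F.suc zero F.≟ a
...   | no q = suc zero , q , λ ()
...   | yes refl = suc (suc zero) , (λ ()) , λ ()

interval : ∀ {b t} → b ≤ t → t ≤ 2 + b → t ≡ b ⊎ t ≡ 1 + b ⊎ t ≡ 2 + b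
interval {b} {t} b≤t t≤2+b with t ≟ b | t ≟ 2 + b
... | yes p | _ = inj₁ p
... | no _ | yes q = inj₂ (inj₂ q)
... | no p | no q = inj₂ (inj₁ (≤-antisym (≤-pred (≤∧≢⇒< t≤2+b q)) (≤∧≢⇒< b≤t (p ∘ sym))))

-- Layered colourings and their elementary modifications.

module Layers {n k : ℕ} where

  Layer : Set
  Layer = Fin n → ℕ

  Colouring : Set
  Colouring = Fin n → Fin k

  Near : ℕ → ℕ → Set
  Near i j = i ≤ suc j × j ≤ suc i

  near-same : ∀ {i j b} → i ≡ b → j ≡ b → Near i j
  near-same refl refl = n≤1+n _ , n≤1+n _

  near-suc : ∀ {i j b} → i ≡ b → j ≡ suc b → Near i j
  near-suc refl refl = ≤-trans (n≤1+n _) (n≤1+n _) , ≤-refl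

  near-sym : ∀ {i j} → Near i j → Near j i
  near-sym (p , q) = q , p

  near-interval : ∀ {i j b} → i ≡ suc b → Near i j → j ≡ b ⊎ j ≡ 1 + b ⊎ j ≡ 2 + b
  near-interval refl (p , q) = interval (≤-pred p) q

  -- Adjacency in the graph that joins all differently coloured vertices in equal or consecutive
  -- layers. Layers and colouring determine this graph, so no separate edge set is carried along.
  Edge : Layer → Colouring → Fin n → Fin n → Set
  Edge l col u v = Near (l u) (l v) × col u ≢ col v

  edge? : ∀ l col u v → Dec (Edge l col u v)
  edge? l col u v = ((l u ≤? suc (l v)) ×-dec (l v ≤? suc (l u))) ×-dec ¬? (col u F.≟ col v)

  edge-sym : ∀ {l col u v} → Edge l col u v → Edge l col v u
  edge-sym (near , ne) = near-sym near , ne ∘ sym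

  degreeIn : Layer → Colouring → Fin n → ℕ
  degreeIn l col v = countF λ u → ⌊ edge? l col v u ⌋

  Has Lacks : Layer → Colouring → ℕ → Fin k → Set
  Has l col i c = ∃ λ v → l v ≡ i × col v ≡ c
  Lacks l col i c = ∀ v → l v ≡ i → col v ≢ c

  has? : ∀ l col i c → Dec (Has l col i c)
  has? l col i c = F.any? λ v → (l v ≟ i) ×-dec (col v F.≟ c)

  ¬has⇒lacks : ∀ {l col i c} → ¬ Has l col i c → Lacks l col i c
  ¬has⇒lacks ¬h v p q = ¬h (v , p , q)

  TwoColoured : Layer → Colouring → ℕ → Set
  TwoColoured l col i = ∃₂ λ u v → l u ≡ i × l v ≡ i × col u ≢ col v

  -- Condition (iii) at layer i, up to i ≥ 2, which holds automatically.
  NotFullBeforeMono : Layer → Colouring → ℕ → Set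
  NotFullBeforeMono l col i = ∃ (Lacks l col i) ⊎ TwoColoured l col (suc i)

  prefixSwap : Layer → ℕ → Fin k → Fin k → Colouring → Colouring
  prefixSwap l i a b col v = if ⌊ l v ≤? i ⌋ then transpose a b (col v) else col v

  module _ {l : Layer} {i : ℕ} {a b : Fin k} {col : Colouring} where

    prefixSwap-below : ∀ {v} → l v ≤ i → prefixSwap l i a b col v ≡ transpose a b (col v)
    prefixSwap-below {v} p rewrite ⇒⌊⌋ (l v ≤? i) p = refl

    prefixSwap-above : ∀ {v} → i < l v → prefixSwap l i a b col v ≡ col v
    prefixSwap-above {v} p rewrite ¬⇒⌊⌋ (l v ≤? i) (<⇒≱ p) = refl

    prefixSwap-layer : ∀ {u v} → l u ≡ l v → col u ≢ col v →
      prefixSwap l i a b col u ≢ prefixSwap l i a b col v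
    prefixSwap-layer {u} {v} e ne e′ with l u ≤? i
    ... | yes p = ne (transpose-injective a b (trans e′ (prefixSwap-below (subst (_≤ i) e p))))
    ... | no ¬p = ne (trans e′ (prefixSwap-above (subst (i <_) e (≰⇒> ¬p))))

    -- Only the edges between layers i and i + 1 can be lost.
    prefixSwap-edge :
      (∀ u v → l u ≡ i → l v ≡ suc i → col u ≢ col v → transpose a b (col u) ≢ col v) →
      ∀ {u v} → Edge l col u v → Edge l (prefixSwap l i a b col) u v
    prefixSwap-edge cross {u} {v} (near@(p , q) , ne) = near , differ
      where
      crossing : ∀ {u v} → l u ≤ i → i < l v → l v ≤ suc (l u) → col u ≢ col v →
        transpose a b (col u) ≢ col v
      crossing {u} {v} s t r = cross u v lu (≤-antisym (≤-trans r (s≤s s)) t)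
        where
        lu : l u ≡ i
        lu = ≤-antisym s (≤-pred (≤-trans t r))
      differ : prefixSwap l i a b col u ≢ prefixSwap l i a b col v
      differ with l u ≤? i | l v ≤? i
      ... | yes _ | yes _ = ne ∘ transpose-injective a b
      ... | no _ | no _ = ne
      ... | yes s | no t = crossing s (≰⇒> t) q ne
      ... | no s | yes t = crossing t (≰⇒> s) p (ne ∘ sym) ∘ sym

    -- A layer is permuted entirely or not at all: a missing colour is replaced by its image, and
    -- two distinct colours stay distinct.
    prefixSwap-notFullBeforeMono : ∀ {j} → NotFullBeforeMono l col j →
      NotFullBeforeMono l (prefixSwap l i a b col) j
    prefixSwap-notFullBeforeMono (inj₂ (u , v , p , q , ne)) =
      inj₂ (u , v , p , q , prefixSwap-layer (trans p (sym q)) ne)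
    prefixSwap-notFullBeforeMono {j} (inj₁ (c , lacks)) with j ≤? i
    ... | yes j≤i = inj₁ (transpose a b c , λ v p e → lacks v p
            (transpose-injective a b (trans (sym (prefixSwap-below (subst (_≤ i) (sym p) j≤i))) e)))
    ... | no j≰i = inj₁ (c , λ v p e → lacks v p
            (trans (sym (prefixSwap-above (subst (i <_) (sym p) (≰⇒> j≰i)))) e))

  module Rooted (D δ : ℕ) (x : Fin n) where

    -- The vertices of layer e are exempt from having a neighbour in the previous layer;
    -- Layering 0 is the case without exemption.
    record Layering (e : ℕ) (l : Layer) (col : Colouring) : Set where
      field
        root        : l x ≡ 0
        root-unique : ∀ {v} → l v ≡ 0 → v ≡ x
        top         : ∃ λ v → l v ≡ D
        bound       : ∀ v → l v ≤ D
        parent      : ∀ {v j} → l v ≡ suc j → suc j ≢ e → ∃ λ u → l u ≡ j × col u ≢ col v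
        degree-≥    : ∀ v → δ ≤ degreeIn l col v
    open Layering

    degreeIn-mono : ∀ {l col l′ col′} →
      (∀ {u v} → Edge l col u v → Edge l′ col′ u v) → ∀ v → degreeIn l col v ≤ degreeIn l′ col′ v
    degreeIn-mono {l} {col} {l′} {col′} mono v =
      countF-mono λ u → ⇒⌊⌋ (edge? l′ col′ v u) ∘ mono ∘ ⌊⌋⇒ (edge? l col v u)

    exempt : ∀ {e l col} → Layering 0 l col → Layering e l col
    exempt L = record { Layering L ; parent = λ p _ → parent L p λ () }

    -- A parent is a neighbour, so parents survive when all edges do, and degrees do not drop.
    recolour : ∀ {e l col col′} → (∀ {u v} → Edge l col u v → Edge l col′ u v) →
      Layering e l col → Layering e l col′
    recolour {e} {l} {col} {col′} mono L = record
      { Layering L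
      ; parent = parent′
      ; degree-≥ = λ v → ≤-trans (degree-≥ L v) (degreeIn-mono mono v)
      }
      where
      parent′ : ∀ {v j} → l v ≡ suc j → suc j ≢ e → ∃ λ u → l u ≡ j × col′ u ≢ col′ v
      parent′ {v} p j≢e with parent L p j≢e
      ... | u , q , ne = u , q , proj₂ (mono (near-suc q p , ne))

    layer-nonempty : ∀ {l col} → Layering 0 l col → ∀ {j} → j ≤ D → ∃ λ v → l v ≡ j
    layer-nonempty {l} L j≤D = go (≤⇒≤′ j≤D) (top L)
      where
      go : ∀ {j d} → j ≤′ d → (∃ λ v → l v ≡ d) → ∃ λ v → l v ≡ j
      go ≤′-refl w = w
      go (≤′-step p) (v , e) with parent L e (λ ())
      ... | u , q , _ = go p (u , q)

    -- The class of colour a in layer m + 2 is moved to layer m + 1; it loses no neighbours, as it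
    -- had none in layer m + 3.
    module Pull {l : Layer} {col : Colouring} (m : ℕ) (a : Fin k)
      (L : Layering (2 + m) l col) (m+2<D : 2 + m < D)
      (a-above : ∀ v → l v ≡ 3 + m → col v ≡ a)
      (a-in : Has l col (2 + m) a)
      (non-a : ∃ λ u → l u ≡ m × col u ≢ a)
      where

      Moved : Fin n → Set
      Moved v = l v ≡ 2 + m × col v ≡ a

      moved? : ∀ v → Dec (Moved v)
      moved? v = (l v ≟ 2 + m) ×-dec (col v F.≟ a)

      pulled : Layer
      pulled v = if ⌊ moved? v ⌋ then suc m else l v

      pulled-moved : ∀ {v} → Moved v → pulled v ≡ suc m
      pulled-moved {v} p rewrite ⇒⌊⌋ (moved? v) p = refl

      pulled-other : ∀ {v} → ¬ Moved v → pulled v ≡ l v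
      pulled-other {v} p rewrite ¬⇒⌊⌋ (moved? v) p = refl

      unmoved : ∀ {v} → l v ≢ 2 + m → pulled v ≡ l v
      unmoved p = pulled-other (p ∘ proj₁)

      pull-edge : ∀ {u v} → Edge l col u v → Edge pulled col u v
      pull-edge {u} {v} ((p , q) , ne) with moved? u | moved? v
      ... | yes (_ , s) | yes (_ , t) = contradiction (trans s (sym t)) ne
      ... | no s | no t = (p , q) , ne
      ... | yes s | no t = near s p q ne , ne
        where
        near : ∀ {u v} → Moved u → l u ≤ suc (l v) → l v ≤ suc (l u) → col u ≢ col v →
          Near (suc m) (l v)
        near {u} {v} (lu , cu) p q ne rewrite lu =
          ≤-trans (n≤1+n _) p , ≤-pred (≤∧≢⇒< q λ lv → ne (trans cu (sym (a-above v lv))))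
      ... | no s | yes (lv , cv) rewrite lv =
          (≤-pred (≤∧≢⇒< p λ lu → ne (trans (a-above u lu) (sym cv))) , ≤-trans (n≤1+n _) q) , ne

      pull : Layering 0 pulled col
      pull = record
        { root = trans (unmoved λ e → case trans (sym e) (root L) of λ ()) (root L)
        ; root-unique = λ {v} → root-unique′ v
        ; top = proj₁ (top L) ,
            trans (unmoved λ e → <⇒≢ m+2<D (trans (sym e) (proj₂ (top L)))) (proj₂ (top L))
        ; bound = bound′
        ; parent = λ {v} p _ → parent′ v p
        ; degree-≥ = λ v → ≤-trans (degree-≥ L v) (degreeIn-mono pull-edge v)
        }
        where
        root-unique′ : ∀ v → pulled v ≡ 0 → v ≡ x
        root-unique′ v p with moved? v
        ... | no _ = root-unique L p
        bound′ : ∀ v → pulled v ≤ D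
        bound′ v with moved? v
        ... | yes _ = ≤-trans (n≤1+n _) (<⇒≤ m+2<D)
        ... | no _ = bound L v
        parent′ : ∀ v {j} → pulled v ≡ suc j → ∃ λ u → pulled u ≡ j × col u ≢ col v
        parent′ v {j} p with moved? v
        parent′ v refl | yes (_ , cv) = let u , lu , cu = non-a in
          u , trans (unmoved λ e → m≢2+m (trans (sym lu) e)) lu , λ e → cu (trans e cv)
          where
          m≢2+m : m ≢ 2 + m
          m≢2+m = <⇒≢ (m≤n⇒m≤1+n ≤-refl)
        parent′ v {j} p | no ¬moved with suc j ≟ 2 + m
        -- A vertex left in layer `2 + m` has a colour other than `a`, so any moved vertex is a
        -- parent for it. This is what removes the exemption.
        ... | yes refl = let u , lu , cu = a-in in
          u , pulled-moved (lu , cu) , λ e → ¬moved (p , trans (sym e) cu)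
        parent′ v {j} p | no ¬moved | no j≢ with parent L p j≢
        ...   | u , lu , ne = u , trans (pulled-other ¬moved-u) lu , ne
          where
          -- If `u` were moved, `v` would lie in layer `3 + m` and share the colour `a` with its
          -- parent `u`.
          ¬moved-u : ¬ Moved u
          ¬moved-u (lu′ , cu) = ne (trans cu (sym (a-above v (trans p (cong suc (trans (sym lu) lu′))))))

-- Exchanging colours vertex by vertex between two consecutive layers.

module Exchange {n k : ℕ} (l : Fin n → ℕ) (m : ℕ) {a b c : Fin k}
  (b≢a : b ≢ a) (c≢a : c ≢ a) (b≢c : b ≢ c) where
  open Layers {n} {k}

  Middle : Fin n → Set
  Middle v = l v ≡ 1 + m ⊎ l v ≡ 2 + m

  middle? : ∀ v → Dec (Middle v)
  middle? v = (l v ≟ 1 + m) ⊎-dec (l v ≟ 2 + m)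

  other? : ∀ (col : Colouring) d v → Dec (Middle v × col v ≢ d)
  other? col d v = middle? v ×-dec ¬? (col v F.≟ d)

  -- The number of neighbours within the two middle layers of a middle vertex of colour `d`. It
  -- depends on the colour alone, as any two middle vertices are in equal or consecutive layers.
  middleDegree : Colouring → Fin k → ℕ
  middleDegree col d = countF λ v → ⌊ other? col d v ⌋

  -- The properties that survive a sequence of exchanges. `keeps-b` later provides parents of colour
  -- `b` for layer `2 + m`.
  record Exchanged (col col′ : Colouring) : Set where
    field
      outside : ∀ {v} → ¬ Middle v → col′ v ≡ col v
      to-a    : ∀ {v} → col v ≡ a → col′ v ≡ a
      from-a  : ∀ {v} → col′ v ≡ a → col v ≡ a
      degrees : ∀ d → middleDegree col d ≤ middleDegree col′ d
      keeps-b : ∀ {v} → l v ≡ 1 + m → col v ≡ b → col′ v ≡ b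
  open Exchanged public

  exchanged-refl : ∀ {col} → Exchanged col col
  exchanged-refl = record
    { outside = λ _ → refl ; to-a = id ; from-a = id ; degrees = λ _ → ≤-refl ; keeps-b = λ _ → id }

  exchanged-trans : ∀ {col₁ col₂ col₃} → Exchanged col₁ col₂ → Exchanged col₂ col₃ → Exchanged col₁ col₃
  exchanged-trans e f = record
    { outside = λ p → trans (outside f p) (outside e p)
    ; to-a = to-a f ∘ to-a e
    ; from-a = from-a e ∘ from-a f
    ; degrees = λ d → ≤-trans (degrees e d) (degrees f d)
    ; keeps-b = λ p → keeps-b f p ∘ keeps-b e p
    }

  c-below? : ∀ (col : Colouring) v → Dec (l v ≡ 1 + m × col v ≡ c)
  c-below? col v = (l v ≟ 1 + m) ×-dec (col v F.≟ c)

  #c-below : Colouring → ℕ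
  #c-below col = countF λ v → ⌊ c-below? col v ⌋

  module Swap {col : Colouring} {u v : Fin n}
    (lu : l u ≡ 1 + m) (cu : col u ≡ c) (lv : l v ≡ 2 + m) (cv : col v ≡ b) where

    -- Exchanging the colours of `u` and `v` is written as a transposition of vertices, an injection
    -- along which counts transfer.
    swapped : Colouring
    swapped w = col (transpose u v w)

    fixed : ∀ {w} → w ≢ u → w ≢ v → swapped w ≡ col w
    fixed p q = cong col (transpose-fixed u v p q)

    below≢v : ∀ {w} → l w ≡ 1 + m → w ≢ v
    below≢v lw refl = <⇒≢ ≤-refl (trans (sym lw) lv)

    transpose-middle : ∀ w → Middle w → Middle (transpose u v w)
    transpose-middle w mw = go (w F.≟ u) (w F.≟ v)
      where
      go : Dec (w ≡ u) → Dec (w ≡ v) → Middle (transpose u v w)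
      go (yes refl) _ = subst Middle (sym (transpose-left u v)) (inj₂ lv)
      go (no _) (yes refl) = subst Middle (sym (transpose-right u v)) (inj₁ lu)
      go (no p) (no q) = subst Middle (sym (transpose-fixed u v p q)) mw

    exchanged : Exchanged col swapped
    exchanged = record
      { outside = λ ¬mid → fixed (λ { refl → ¬mid (inj₁ lu) }) (λ { refl → ¬mid (inj₂ lv) })
      ; to-a = λ e → trans (fixed (≢u e) (≢v e)) e
      ; from-a = λ {w} e → trans (cong col (trans (sym (transpose-involutive u v w))
                              (transpose-fixed u v (≢u e) (≢v e)))) e
      ; degrees = λ d → countF-image _ _ (transpose u v) (λ _ _ → transpose-injective u v)
          (λ w p → let mw , ne = ⌊⌋⇒ (other? col d w) p in
            ⇒⌊⌋ (other? swapped d (transpose u v w))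
              (transpose-middle w mw , ne ∘ trans (sym (cong col (transpose-involutive u v w)))))
      ; keeps-b = λ lw e → trans (fixed (λ { refl → b≢c (trans (sym e) cu) }) (below≢v lw)) e
      }
      where
      ≢u : ∀ {w} → col w ≡ a → w ≢ u
      ≢u e refl = c≢a (trans (sym cu) e)
      ≢v : ∀ {w} → col w ≡ a → w ≢ v
      ≢v e refl = b≢a (trans (sym cv) e)

    -- `u` turns from `c` to `b`, while the vertex that receives `c` lies in layer `2 + m` and is
    -- not counted.
    #c-below-< : #c-below swapped < #c-below col
    #c-below-< = countF-mono-<
      (λ w p → ⇒⌊⌋ (c-below? col w) (old w (⌊⌋⇒ (c-below? swapped w) p)))
      u (¬⇒⌊⌋ (c-below? swapped u) λ { (_ , e) → b≢c (trans (sym new-u) e) })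
      (⇒⌊⌋ (c-below? col u) (lu , cu))
      where
      new-u : swapped u ≡ b
      new-u = trans (cong col (transpose-left u v)) cv
      old : ∀ w → l w ≡ 1 + m × swapped w ≡ c → l w ≡ 1 + m × col w ≡ c
      old w (lw , e) = lw , trans (sym (fixed (λ { refl → b≢c (trans (sym new-u) e) }) (below≢v lw))) e

  -- Every swap takes one `c` out of layer `1 + m`, which bounds their number. The second outcome
  -- records a remaining `c` there, since it will serve as a parent.
  exchange : ∀ col → ∃ λ col′ → Exchanged col col′ ×
    (Lacks l col′ (1 + m) c ⊎ (Has l col′ (1 + m) c × Lacks l col′ (2 + m) b))
  exchange col = go (suc (#c-below col)) col ≤-refl
    where
    go : ∀ fuel col → #c-below col < fuel → ∃ λ col′ → Exchanged col col′ ×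
      (Lacks l col′ (1 + m) c ⊎ (Has l col′ (1 + m) c × Lacks l col′ (2 + m) b))
    go (suc fuel) col (s≤s le) with has? l col (1 + m) c
    ... | no ¬h = col , exchanged-refl , inj₁ (¬has⇒lacks ¬h)
    ... | yes h@(u , lu , cu) with has? l col (2 + m) b
    ...   | no ¬h′ = col , exchanged-refl , inj₂ (h , ¬has⇒lacks ¬h′)
    ...   | yes (v , lv , cv) with go fuel _ (<-≤-trans (Swap.#c-below-< lu cu lv cv) le)
    ...     | col′ , e , r = col′ , exchanged-trans (Swap.exchanged lu cu lv cv) e , r

  module _ {D δ : ℕ} {x : Fin n} where
    open Rooted D δ x
    open Layering

    module _ {col : Colouring} (L : Layering 0 l col)
      (a-below : ∀ {v} → l v ≡ m → col v ≡ a)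
      (a-above : ∀ {v} → l v ≡ 3 + m → col v ≡ a)
      (has-below : ∀ d → d ≢ a → Has l col (1 + m) d)
      (has-above : ∀ d → Has l col (2 + m) d) where

      layerCount : ℕ → ℕ
      layerCount j = countF λ v → ⌊ l v ≟ j ⌋

      -- All neighbours of a vertex in layer `1 + m` lie in layer `m` or the middle layers. The
      -- bound mentions only its colour, so it passes to whichever vertex of that layer has colour
      -- `d` after the exchanges; `degree-above` does the same for layer `2 + m`.
      degree-below : ∀ d → d ≢ a → δ ≤ middleDegree col d + layerCount m
      degree-below d d≢a with has-below d d≢a
      ... | w , lw , refl = ≤-trans (degree-≥ L w) (countF-cover cover)
        where
        cover : ∀ u → ⌊ edge? l col w u ⌋ ≡ true →
          ⌊ other? col (col w) u ⌋ ≡ true ⊎ ⌊ l u ≟ m ⌋ ≡ true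
        cover u e with ⌊⌋⇒ (edge? l col w u) e
        ... | near , ne with near-interval lw near
        ...   | inj₁ r = inj₂ (⇒⌊⌋ (l u ≟ m) r)
        ...   | inj₂ r = inj₁ (⇒⌊⌋ (other? col (col w) u) (r , ne ∘ sym))

      degree-above : ∀ d → δ ≤ middleDegree col d + layerCount (3 + m)
      degree-above d with has-above d
      ... | w , lw , refl = ≤-trans (degree-≥ L w) (countF-cover cover)
        where
        cover : ∀ u → ⌊ edge? l col w u ⌋ ≡ true →
          ⌊ other? col (col w) u ⌋ ≡ true ⊎ ⌊ l u ≟ 3 + m ⌋ ≡ true
        cover u e with ⌊⌋⇒ (edge? l col w u) e
        ... | near , ne with near-interval lw near
        ...   | inj₁ r = inj₁ (⇒⌊⌋ (other? col (col w) u) (inj₁ r , ne ∘ sym))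
        ...   | inj₂ (inj₁ r) = inj₁ (⇒⌊⌋ (other? col (col w) u) (inj₂ r , ne ∘ sym))
        ...   | inj₂ (inj₂ r) = inj₂ (⇒⌊⌋ (l u ≟ 3 + m) r)

      module _ {col′ : Colouring} (E : Exchanged col col′) where

        differ-a : ∀ {u v} → col u ≡ a → col u ≢ col v → col′ u ≢ col′ v
        differ-a p ne e = ne (trans p (sym (from-a E (trans (sym e) (to-a E p)))))

        differ-outside : ∀ {u v} → ¬ Middle u → ¬ Middle v → col u ≢ col v → col′ u ≢ col′ v
        differ-outside p q ne e = ne (trans (sym (outside E p)) (trans e (outside E q)))

        neighbour-of-middle : ∀ {u v} → Middle u → ¬ Middle v → Near (l u) (l v) → col v ≡ a
        neighbour-of-middle (inj₁ lu) ¬mid near with near-interval lu near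
        ... | inj₁ r = a-below r
        ... | inj₂ r = contradiction r ¬mid
        neighbour-of-middle (inj₂ lu) ¬mid near with near-interval lu near
        ... | inj₁ r = contradiction (inj₁ r) ¬mid
        ... | inj₂ (inj₁ r) = contradiction (inj₂ r) ¬mid
        ... | inj₂ (inj₂ r) = a-above r

        -- A vertex outside the middle layers but within one layer of a middle vertex has colour
        -- `a`, and exchanges leave the class of `a` alone.
        keeps-edge : ∀ {v u} → ¬ Middle v ⊎ col v ≡ a → Edge l col v u → Edge l col′ v u
        keeps-edge (inj₂ p) (near , ne) = near , differ-a p ne
        keeps-edge {v} {u} (inj₁ ¬mid) (near , ne) with middle? u
        ... | no ¬mid′ = near , differ-outside ¬mid ¬mid′ ne
        ... | yes mid = near , differ-a (neighbour-of-middle mid ¬mid (proj₂ near , proj₁ near)) ne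

        -- Layer `j`, which will be `m` or `3 + m`, has only the colour `a`, so a vertex of another
        -- colour is joined to all of it.
        middleDegree-+ : ∀ {v j} → Middle v → (∀ {u} → Middle u → Near (l v) (l u)) →
          (∀ {u} → l u ≡ j → Near (l v) (l u)) → (∀ {u} → l u ≡ j → ¬ Middle u) →
          (∀ {u} → l u ≡ j → col u ≡ a) → col′ v ≢ a →
          middleDegree col (col′ v) + layerCount j ≤ degreeIn l col′ v
        middleDegree-+ {v} {j} mid near near-j ¬mid-j col-j v≢a =
          ≤-trans (+-monoˡ-≤ (layerCount j) (degrees E (col′ v))) (countF-disjoint
            (λ u p q → ¬mid-j (⌊⌋⇒ (l u ≟ j) q) (proj₁ (⌊⌋⇒ (other? col′ (col′ v) u) p)))
            (λ u p → let mu , ne = ⌊⌋⇒ (other? col′ (col′ v) u) p in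
              ⇒⌊⌋ (edge? l col′ v u) (near mu , ne ∘ sym))
            (λ u p → let lu = ⌊⌋⇒ (l u ≟ j) p in
              ⇒⌊⌋ (edge? l col′ v u) (near-j lu , λ e → v≢a (trans e (to-a E (col-j lu))))))

        degree-≥′ : ∀ v → δ ≤ degreeIn l col′ v
        degree-≥′ v with middle? v | col′ v F.≟ a
        ... | no ¬mid | _ = ≤-trans (degree-≥ L v)
          (countF-mono λ u → ⇒⌊⌋ (edge? l col′ v u) ∘ keeps-edge (inj₁ ¬mid) ∘ ⌊⌋⇒ (edge? l col v u))
        ... | yes _ | yes p = ≤-trans (degree-≥ L v)
          (countF-mono λ u → ⇒⌊⌋ (edge? l col′ v u) ∘ keeps-edge (inj₂ (from-a E p)) ∘ ⌊⌋⇒ (edge? l col v u))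
        ... | yes mid@(inj₁ lv) | no v≢a = ≤-trans (degree-below (col′ v) v≢a)
          (middleDegree-+ mid near (λ lu → near-sym (near-suc lu lv))
            (λ { lu (inj₁ e) → <⇒≢ ≤-refl (trans (sym lu) e)
               ; lu (inj₂ e) → <⇒≢ (n≤1+n _) (trans (sym lu) e) }) a-below v≢a)
          where
          near : ∀ {u} → Middle u → Near (l v) (l u)
          near (inj₁ lu) = near-same lv lu
          near (inj₂ lu) = near-suc lv lu
        ... | yes mid@(inj₂ lv) | no v≢a = ≤-trans (degree-above (col′ v))
          (middleDegree-+ mid near (near-suc lv)
            (λ { lu (inj₁ e) → <⇒≢ (n≤1+n _) (trans (sym e) lu)
               ; lu (inj₂ e) → <⇒≢ ≤-refl (trans (sym e) lu) }) a-above v≢a)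
          where
          near : ∀ {u} → Middle u → Near (l v) (l u)
          near (inj₁ lu) = near-sym (near-suc lu lv)
          near (inj₂ lu) = near-same lv lu

        -- Exchanges can destroy parents only between the two middle layers, hence the exemption of
        -- layer `2 + m`: parents in layer `m` have colour `a`, and vertices outside the middle keep
        -- all their edges.
        exchanged-layering : Layering (2 + m) l col′
        exchanged-layering = record { Layering L ; parent = parent′ ; degree-≥ = degree-≥′ }
          where
          parent′ : ∀ {v j} → l v ≡ suc j → suc j ≢ 2 + m → ∃ λ u → l u ≡ j × col′ u ≢ col′ v
          parent′ {v} {j} lv j≢ with parent L lv (λ ()) | j ≟ m
          ... | u , lu , ne | yes refl = u , lu , differ-a (a-below lu) ne
          ... | u , lu , ne | no j≢m = u , lu ,
                keeps-edge′ (λ { (inj₁ e) → j≢m (suc-injective (trans (sym lv) e))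
                               ; (inj₂ e) → j≢ (trans (sym lv) e) })
            where
            keeps-edge′ : ¬ Middle v → col′ u ≢ col′ v
            keeps-edge′ ¬mid = proj₂ (keeps-edge (inj₁ ¬mid) (near-sym (near-suc lu lv) , ne ∘ sym)) ∘ sym

-- Condition (iii): full layers before monochromatic ones.

module Unblocking {n k : ℕ} (3≤k : 3 ≤ k) (D δ : ℕ) (x : Fin n) where
  open Layers {n} {k}
  open Rooted D δ x
  open Layering

  -- Changes are confined to the layers up to `i`, and no vertex leaves these upwards; conditions
  -- settled beyond `i` therefore persist.
  record Agree (i : ℕ) (l : Layer) (col : Colouring) (l′ : Layer) (col′ : Colouring) : Set where
    field
      layer-above  : ∀ {v} → i < l v → l′ v ≡ l v
      colour-above : ∀ {v} → i < l v → col′ v ≡ col v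
      below        : ∀ {v} → l v ≤ i → l′ v ≤ i
  open Agree

  agree-above : ∀ {i l col l′ col′} → Agree i l col l′ col′ → ∀ {v} → i < l′ v → i < l v
  agree-above {i} {l} A {v} p with l v ≤? i
  ... | yes q = contradiction (below A q) (<⇒≱ p)
  ... | no q = ≰⇒> q

  agree-layer : ∀ {i l col l′ col′ v j} → Agree i l col l′ col′ → i < j → l′ v ≡ j →
    l v ≡ j × col′ v ≡ col v
  agree-layer {i} A i<j refl = trans (sym (layer-above A p)) refl , colour-above A p
    where p = agree-above A i<j

  agree-notFullBeforeMono : ∀ {i j l col l′ col′} → Agree i l col l′ col′ → i < j →
    NotFullBeforeMono l col j → NotFullBeforeMono l′ col′ j
  agree-notFullBeforeMono A i<j (inj₁ (c , lacks)) = inj₁ (c , λ v p e →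
    let q , r = agree-layer A i<j p in lacks v q (trans (sym r) e))
  agree-notFullBeforeMono {i} {j} A i<j (inj₂ (u , v , p , q , ne)) =
    inj₂ (u , v , trans (layer-above A (above p)) p , trans (layer-above A (above q)) q ,
      λ e → ne (trans (sym (colour-above A (above p))) (trans e (colour-above A (above q)))))
    where
    above : ∀ {t} → t ≡ suc j → i < t
    above refl = <-trans i<j ≤-refl

  Unblocked : ℕ → Layer → Colouring → Set
  Unblocked i l col = ∃₂ λ l′ col′ → Layering 0 l′ col′ × Agree i l col l′ col′ × ∃ (Lacks l′ col′ i)

  prefixSwap-agree : ∀ {l col i j a b} → j ≤ i → Agree i l col l (prefixSwap l j a b col)
  prefixSwap-agree {l} {col} j≤i = record
    { layer-above = λ _ → refl
    ; colour-above = λ p → prefixSwap-above {l} {col = col} (≤-<-trans j≤i p)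
    ; below = id
    }

  agree-trans : ∀ {i l₁ col₁ l₂ col₂ l₃ col₃} → Agree i l₁ col₁ l₂ col₂ → Agree i l₂ col₂ l₃ col₃ →
    Agree i l₁ col₁ l₃ col₃
  agree-trans {i} A B = record
    { layer-above = λ p → trans (layer-above B (above p)) (layer-above A p)
    ; colour-above = λ p → trans (colour-above B (above p)) (colour-above A p)
    ; below = below B ∘ below A
    }
    where
    above : ∀ {v} → i < _ → i < _
    above {v} p = subst (i <_) (sym (layer-above A {v} p)) p

  unblocked-agree : ∀ {i l col l′ col′} → Agree i l col l′ col′ → Unblocked i l′ col′ → Unblocked i l col
  unblocked-agree A (_ , _ , L , B , c) = _ , _ , L , agree-trans A B , c

  unblock-pull : ∀ {l col m a} → Layering (2 + m) l col → 2 + m < D →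
    (∀ v → l v ≡ 3 + m → col v ≡ a) → Has l col (2 + m) a → (∃ λ u → l u ≡ m × col u ≢ a) →
    Unblocked (2 + m) l col
  unblock-pull {l} {col} {m} {a} L i<D a-above a-in non-a =
    pulled , col , pull , agree , a , lacks
    where
    open Pull m a L i<D a-above a-in non-a
    agree : Agree (2 + m) l col pulled col
    agree = record
      { layer-above = λ p → unmoved (λ e → <⇒≢ p (sym e))
      ; colour-above = λ _ → refl
      ; below = λ {v} → below′ v
      }
      where
      below′ : ∀ v → l v ≤ 2 + m → pulled v ≤ 2 + m
      below′ v p with moved? v
      ... | yes _ = n≤1+n _
      ... | no _ = p
    lacks : Lacks pulled col (2 + m) a
    lacks v p e with moved? v
    ... | yes _ = <⇒≢ ≤-refl p
    ... | no ¬moved = ¬moved (p , e)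

  -- Layer `m` has only the colour `a`. Exchanging `a` and `c` up to layer `m` turns it into `c`,
  -- which layer `1 + m` lacks: no edge is lost, and the pulled vertices find parents of a colour
  -- other than `a`.
  unblock-swap-pull : ∀ {l col m a c} → Layering (2 + m) l col → 2 + m < D →
    (∀ v → l v ≡ 3 + m → col v ≡ a) → Has l col (2 + m) a →
    (∀ {v} → l v ≡ m → col v ≡ a) → (∃ λ u → l u ≡ m) → Lacks l col (1 + m) c → c ≢ a →
    Unblocked (2 + m) l col
  unblock-swap-pull {l} {col} {m} {a} {c} L i<D a-above (w , lw , cw) a-below (z , lz) lacks c≢a =
    unblocked-agree (prefixSwap-agree m≤2+m)
      (unblock-pull (recolour (prefixSwap-edge {l} {col = col} cross) L) i<D
        (λ v p → trans (prefixSwap-above {l} {col = col} (subst (m <_) (sym p) (s≤s m≤2+m))) (a-above v p))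
        (w , lw , trans (prefixSwap-above {l} {col = col} (subst (m <_) (sym lw) (n≤1+n (suc m)))) cw)
        (z , lz , λ e → c≢a (trans (sym (new (a-below lz)))
          (trans (sym (prefixSwap-below {l} {col = col} (≤-reflexive lz))) e))))
    where
    m≤2+m : m ≤ 2 + m
    m≤2+m = ≤-trans (n≤1+n m) (n≤1+n (suc m))
    new : ∀ {d} → d ≡ a → transpose a c d ≡ c
    new refl = transpose-left a c
    cross : ∀ u v → l u ≡ m → l v ≡ suc m → col u ≢ col v → transpose a c (col u) ≢ col v
    cross u v lu lv _ e = lacks v lv (trans (sym e) (new (a-below lu)))

  -- As layer `i` has no `b`, it has no `a` after the exchange, so all its vertices are joined to
  -- all of layer `suc i`.
  unblock-swap : ∀ {l col i a b} → Layering 0 l col → (∀ v → l v ≡ suc i → col v ≡ a) →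
    Lacks l col i b → b ≢ a → Unblocked i l col
  unblock-swap {l} {col} {i} {a} {b} L a-above lacks b≢a =
    l , prefixSwap l i a b col , recolour (prefixSwap-edge {l} {col = col} cross) L , prefixSwap-agree ≤-refl ,
    a , λ v lv e → absent v lv (trans (sym (prefixSwap-below {l} {col = col} (≤-reflexive lv))) e)
    where
    absent : ∀ v → l v ≡ i → transpose a b (col v) ≢ a
    absent v lv e = lacks v lv (trans (transpose-flip a b e) (transpose-left a b))
    cross : ∀ u v → l u ≡ i → l v ≡ suc i → col u ≢ col v → transpose a b (col u) ≢ col v
    cross u v lu lv _ e = absent u lu (trans e (a-above v lv))

  module _ {l : Layer} {col : Colouring} (L : Layering 0 l col) where

    lacks-or-full : ∀ i → ∃ (Lacks l col i) ⊎ (∀ c → Has l col i c)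
    lacks-or-full i with F.any? (λ c → ¬? (has? l col i c))
    ... | yes (c , ¬h) = inj₁ (c , ¬has⇒lacks ¬h)
    ... | no ¬w = inj₂ λ c → case has? l col i c of λ where
      (yes h) → h
      (no ¬h) → contradiction (c , ¬h) ¬w

    ¬full-0 : ¬ (∀ c → Has l col 0 c)
    ¬full-0 full with fresh 3≤k (col x) (col x)
    ... | c , c≢ , _ with full c
    ...   | v , p , e with refl ← root-unique L p = c≢ (sym e)

    ¬full-1 : ¬ (∀ c → Has l col 1 c)
    ¬full-1 full with full (col x)
    ... | v , p , e with parent L p (λ ())
    ...   | u , q , ne with refl ← root-unique L q = ne (sym e)

    -- Layer 0 is a single vertex, and the root is the only possible parent in layer 1, so the
    -- colour of the root is missing there.
    full⇒2≤ : ∀ i → (∀ c → Has l col i c) → 2 ≤ i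
    full⇒2≤ zero full = contradiction full ¬full-0
    full⇒2≤ (suc zero) full = contradiction full ¬full-1
    full⇒2≤ (suc (suc _)) _ = s≤s (s≤s z≤n)

    module _ {m a} (i<D : 2 + m < D) (full : ∀ c → Has l col (2 + m) c)
      (a-above : ∀ v → l v ≡ 3 + m → col v ≡ a) where

      m≤D : m ≤ D
      m≤D = ≤-trans (n≤1+n m) (≤-trans (n≤1+n (suc m)) (<⇒≤ i<D))

      unblock-exchange : ∀ {b c} → b ≢ a → c ≢ a → b ≢ c → (∀ {v} → l v ≡ m → col v ≡ a) →
        (∀ d → d ≢ a → Has l col (1 + m) d) → Unblocked (2 + m) l col
      unblock-exchange {b} {c} b≢a c≢a b≢c a-below has-below = go (exchange col)
        where
        open Exchange l m b≢a c≢a b≢c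
        above : ∀ {v} → 2 + m < l v → ¬ Middle v
        above p (inj₁ e) = <⇒≢ (<-trans ≤-refl p) (sym e)
        above p (inj₂ e) = <⇒≢ p (sym e)
        agree : ∀ {col′} → Exchanged col col′ → Agree (2 + m) l col l col′
        agree E = record
          { layer-above = λ _ → refl ; colour-above = outside E ∘ above ; below = id }
        layering : ∀ {col′} → Exchanged col col′ → Layering (2 + m) l col′
        layering = exchanged-layering L a-below (λ {v} → a-above v) has-below full
        a-above′ : ∀ {col′} → Exchanged col col′ → ∀ v → l v ≡ 3 + m → col′ v ≡ a
        a-above′ E v = to-a E ∘ a-above v
        go : (∃ λ col′ → Exchanged col col′ ×
          (Lacks l col′ (1 + m) c ⊎ (Has l col′ (1 + m) c × Lacks l col′ (2 + m) b))) →
          Unblocked (2 + m) l col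
        go (col′ , E , inj₁ lacks) = unblocked-agree (agree E)
          (unblock-swap-pull (layering E) i<D (a-above′ E)
            (let w , lw , cw = full a in w , lw , to-a E cw)
            (to-a E ∘ a-below) (layer-nonempty L m≤D) lacks c≢a)
        go (col′ , E , inj₂ ((w , lw , cw) , lacks)) = unblocked-agree (agree E)
          (unblock-swap (record { Layering (layering E) ; parent = λ {v} p _ → parent′ p })
            (a-above′ E) lacks b≢a)
          where
          parent′ : ∀ {v j} → l v ≡ suc j → ∃ λ u → l u ≡ j × col′ u ≢ col′ v
          parent′ {v} {j} p with suc j ≟ 2 + m
          ... | no j≢ = parent (layering E) p j≢
          ... | yes refl with col′ v F.≟ c
          -- The remaining `c` in layer `1 + m` is a parent for every colour but `c`. A vertex of
          -- colour `c` gets a parent of colour `b`, as no exchange recolours a `b` in layer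
          -- `1 + m`.
          ...   | no ne = w , lw , λ e → ne (trans (sym e) cw)
          ...   | yes cv = let u , lu , cu = has-below b b≢a in
                    u , lu , λ e → b≢c (trans (sym (keeps-b E lu cu)) (trans e cv))

      unblock-full : Unblocked (2 + m) l col
      unblock-full with F.any? (λ u → (l u ≟ m) ×-dec ¬? (col u F.≟ a))
      ... | yes non-a = unblock-pull (exempt L) i<D a-above (full a) non-a
      ... | no ¬non-a = below-mono
        where
        a-below : ∀ {v} → l v ≡ m → col v ≡ a
        a-below {v} p with col v F.≟ a
        ... | yes e = e
        ... | no ne = contradiction (v , p , ne) ¬non-a
        below-mono : Unblocked (2 + m) l col
        below-mono with F.any? (λ c → ¬? (c F.≟ a) ×-dec ¬? (has? l col (1 + m) c))
        ... | yes (c , c≢a , ¬h) = unblock-swap-pull (exempt L) i<D a-above (full a) a-below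
                (layer-nonempty L m≤D) (¬has⇒lacks ¬h) c≢a
        -- Three colours leave two distinct ones besides `a` for the exchange.
        ... | no ¬missing with fresh 3≤k a a
        ...   | b , b≢a , _ with fresh 3≤k a b
        ...     | c , c≢a , c≢b = unblock-exchange b≢a c≢a (c≢b ∘ sym) a-below has-below
          where
          has-below : ∀ d → d ≢ a → Has l col (1 + m) d
          has-below d d≢a with has? l col (1 + m) d
          ... | yes h = h
          ... | no ¬h = contradiction (d , d≢a , ¬h) ¬missing

    unblock : ∀ {i} → i < D → NotFullBeforeMono l col i ⊎ Unblocked i l col
    unblock {i} i<D with lacks-or-full i
    ... | inj₁ w = inj₁ (inj₁ w)
    ... | inj₂ full with layer-nonempty L i<D
    ...   | y , ly with F.any? (λ v → (l v ≟ suc i) ×-dec ¬? (col v F.≟ col y))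
    ...     | yes (v , lv , ne) = inj₁ (inj₂ (v , y , lv , ly , ne))
    ...     | no ¬w with full⇒2≤ i full
    ...       | s≤s (s≤s {n = m} _) = inj₂ (unblock-full i<D full mono)
      where
      mono : ∀ v → l v ≡ 3 + m → col v ≡ col y
      mono v p with col v F.≟ col y
      ... | yes e = e
      ... | no ne = contradiction (v , p , ne) ¬w

  -- A blocked layer is treated after all layers beyond it, since treating it changes nothing there.
  unblock-all : ∀ {l col} → Layering 0 l col →
    ∃₂ λ l′ col′ → Layering 0 l′ col′ × (∀ i → i < D → NotFullBeforeMono l′ col′ i)
  unblock-all L = go D ≤-refl L λ i D≤i i<D → contradiction i<D (≤⇒≯ D≤i)
    where
    go : ∀ m {l col} → m ≤ D → Layering 0 l col → (∀ i → m ≤ i → i < D → NotFullBeforeMono l col i) →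
      ∃₂ λ l′ col′ → Layering 0 l′ col′ × (∀ i → i < D → NotFullBeforeMono l′ col′ i)
    go zero _ L done = _ , _ , L , λ i → done i z≤n
    go (suc m) {l} {col} m<D L done with unblock L m<D
    ... | inj₁ c = go m (<⇒≤ m<D) L extend
      where
      extend : ∀ i → m ≤ i → i < D → NotFullBeforeMono l col i
      extend i m≤i i<D with m≤n⇒m<n∨m≡n m≤i
      ... | inj₁ m<i = done i m<i i<D
      ... | inj₂ refl = c
    ... | inj₂ (l′ , col′ , L′ , A , w) = go m (<⇒≤ m<D) L′ extend
      where
      extend : ∀ i → m ≤ i → i < D → NotFullBeforeMono l′ col′ i
      extend i m≤i i<D with m≤n⇒m<n∨m≡n m≤i
      ... | inj₁ m<i = agree-notFullBeforeMono A m<i (done i m<i i<D)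
      ... | inj₂ refl = inj₁ w

all-or : ∀ {P : ℕ → Set} {Q : Set} d → (∀ i → i < d → P i ⊎ Q) → (∀ i → i < d → P i) ⊎ Q
all-or zero h = inj₁ λ _ ()
all-or {P} (suc d) h with h d ≤-refl | all-or {P} d (λ i i<d → h i (<-trans i<d ≤-refl))
... | inj₂ q | _ = inj₂ q
... | inj₁ _ | inj₂ q = inj₂ q
... | inj₁ p | inj₁ ps = inj₁ λ i i<d → case m≤n⇒m<n∨m≡n (≤-pred i<d) of λ where
  (inj₁ lt) → ps i lt
  (inj₂ refl) → p

-- Conditions (ii) and (iv): increasing the number of edges on fixed layers.

module Maximal {n k : ℕ} (D δ : ℕ) (x : Fin n) (l : Fin n → ℕ) where
  open Layers {n} {k}
  open Rooted D δ x
  open Layering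

  -- Conditions (ii) and (iv) at layer i.
  Separated Diverse : Colouring → ℕ → Set
  Separated col i = ∀ a b → Has l col i a → Has l col (suc i) a → Has l col i b ⊎ Has l col (suc i) b
  Diverse col i = ∀ u v → l u ≡ i → l v ≡ i → u ≢ v → col u ≡ col v → 0 < i ×
    ((∀ b → Has l col (i ∸ 1) b ⊎ Has l col i b) ⊎ (∀ b → Has l col i b ⊎ Has l col (suc i) b))

  pair : Fin (n * n) → Fin n × Fin n
  pair = F.remQuot n

  -- Ordered pairs are counted, so each edge counts twice and `n * n` is an upper bound.
  edgeCount : Colouring → ℕ
  edgeCount col = countF λ p → ⌊ edge? l col (proj₁ (pair p)) (proj₂ (pair p)) ⌋

  edgeCount-< : ∀ {col col′} → (∀ {u v} → Edge l col u v → Edge l col′ u v) →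
    ∀ u v → ¬ Edge l col u v → Edge l col′ u v → edgeCount col < edgeCount col′
  edgeCount-< {col} {col′} mono u v old new = countF-mono-<
    (λ p → ⇒⌊⌋ (edge? l col′ _ _) ∘ mono ∘ ⌊⌋⇒ (edge? l col _ _))
    (F.combine u v)
    (¬⇒⌊⌋ (edge? l col _ _) (old ∘ subst (λ (s , t) → Edge l col s t) eq))
    (⇒⌊⌋ (edge? l col′ _ _) (subst (λ (s , t) → Edge l col′ s t) (sym eq) new))
    where
    eq : pair (F.combine u v) ≡ (u , v)
    eq = F.remQuot-combine u v

  Open : Colouring → Set
  Open col = ∀ i → i < D → NotFullBeforeMono l col i

  Better : Colouring → Set
  Better col = ∃ λ col′ → Layering 0 l col′ × Open col′ × edgeCount col < edgeCount col′

  covered? : ∀ col i j → (∀ b → Has l col i b ⊎ Has l col j b) ⊎ ∃ λ b → Lacks l col i b × Lacks l col j b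
  covered? col i j with F.any? (λ b → ¬? (has? l col i b) ×-dec ¬? (has? l col j b))
  ... | yes (b , p , q) = inj₂ (b , ¬has⇒lacks p , ¬has⇒lacks q)
  ... | no ¬w = inj₁ λ b → case (has? l col i b) of λ where
    (yes h) → inj₁ h
    (no ¬h) → case (has? l col j b) of λ where
      (yes h′) → inj₂ h′
      (no ¬h′) → contradiction (b , ¬h , ¬h′) ¬w

  module _ {col : Colouring} (L : Layering 0 l col) (open-col : Open col) where

    separate : ∀ i → Separated col i ⊎ Better col
    separate i with covered? col i (suc i)
    ... | inj₁ cov = inj₁ λ _ b _ _ → cov b
    ... | inj₂ (b , lacks , lacks′) with F.any? (λ a → has? l col i a ×-dec has? l col (suc i) a)
    ...   | no ¬w = inj₁ λ a _ h h′ → contradiction (a , h , h′) ¬w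
    ...   | yes (a , (u , lu , cu) , (v , lv , cv)) = inj₂
              (_ , recolour grows L , (λ j j<D → prefixSwap-notFullBeforeMono (open-col j j<D)) ,
               edgeCount-< grows u v (λ { (_ , ne) → ne (trans cu (sym cv)) }) (near-suc lu lv , differ))
      where
      cross : ∀ u v → l u ≡ i → l v ≡ suc i → col u ≢ col v → transpose a b (col u) ≢ col v
      -- In layer `i`, `a` becomes `b`, which layer `suc i` lacks; every other colour is fixed, as
      -- `b` does not occur in layer `i`.
      cross u v lu lv ne e = go (col u F.≟ a)
        where
        go : ¬ Dec (col u ≡ a)
        go (yes refl) = lacks′ v lv (trans (sym e) (transpose-left a b))
        go (no cu≢a) = ne (trans (sym (transpose-fixed a b cu≢a (lacks u lu))) e)
      grows : ∀ {u v} → Edge l col u v → Edge l (prefixSwap l i a b col) u v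
      grows = prefixSwap-edge cross
      differ : prefixSwap l i a b col u ≢ prefixSwap l i a b col v
      differ e = lacks′ v lv (trans (sym (prefixSwap-above {l} {col = col} (≤-reflexive (sym lv))))
        (trans (sym e) (trans (prefixSwap-below {l} {col = col} (≤-reflexive lu))
          (trans (cong (transpose a b) cu) (transpose-left a b)))))

    module _ {i u v b b′} (lu : l u ≡ suc i) (lv : l v ≡ suc i) (u≢v : u ≢ v) (cuv : col u ≡ col v)
      (i<D : i < D) (separated : Separated col i)
      (b-below : Lacks l col i b) (b-in : Lacks l col (suc i) b)
      (b′-in : Lacks l col (suc i) b′) (b′-above : Lacks l col (2 + i) b′) where

      swapped recoloured : Colouring
      swapped = prefixSwap l (suc i) b b′ col
      recoloured w = if ⌊ w F.≟ v ⌋ then b′ else swapped w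

      recoloured-v : recoloured v ≡ b′
      recoloured-v rewrite ⇒⌊⌋ (v F.≟ v) refl = refl

      recoloured-other : ∀ {w} → w ≢ v → recoloured w ≡ swapped w
      recoloured-other {w} p rewrite ¬⇒⌊⌋ (w F.≟ v) p = refl

      below-absent : ∀ {w} → l w ≤ suc i → col w ≢ b → swapped w ≢ b′
      below-absent p ne e = ne (trans (transpose-flip b b′
        (trans (sym (prefixSwap-below {l} {col = col} p)) e)) (transpose-right b b′))

      -- In layers `i` and `suc i` the missing `b` becomes a missing `b′`; layer `2 + i` is not
      -- permuted and lacked `b′` from the start.
      absent : ∀ {w} → Near (suc i) (l w) → swapped w ≢ b′
      absent {w} near with near-interval refl near
      ... | inj₁ lw = below-absent (≤-trans (≤-reflexive lw) (n≤1+n i)) (b-below w lw)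
      ... | inj₂ (inj₁ lw) = below-absent (≤-reflexive lw) (b-in w lw)
      ... | inj₂ (inj₂ lw) = λ e → b′-above w lw
              (trans (sym (prefixSwap-above {l} {col = col} (≤-reflexive (sym lw)))) e)

      -- Layer `suc i` has neither `b` nor `b′`, so the exchange fixes its colours and loses no edge
      -- to layer `2 + i`.
      swap-grows : ∀ {s t} → Edge l col s t → Edge l swapped s t
      swap-grows = prefixSwap-edge cross
        where
        cross : ∀ s t → l s ≡ suc i → l t ≡ 2 + i → col s ≢ col t → transpose b b′ (col s) ≢ col t
        cross s t ls lt ne = ne ∘ trans (sym (transpose-fixed b b′ (b-in s ls) (b′-in s ls)))

      recolour-grows : ∀ {s t} → Edge l swapped s t → Edge l recoloured s t
      recolour-grows {s} {t} ((p , q) , ne) with s F.≟ v | t F.≟ v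
      ... | yes refl | yes refl = contradiction refl ne
      ... | no _ | no _ = (p , q) , ne
      ... | yes refl | no _ = (p , q) , absent (subst (λ j → Near j (l t)) lv (p , q)) ∘ sym
      ... | no _ | yes refl = (p , q) , absent (subst (λ j → Near j (l s)) lv (q , p))

      grows : ∀ {s t} → Edge l col s t → Edge l recoloured s t
      grows = recolour-grows ∘ swap-grows

      -- Condition (iii) at layer `suc i` may have rested on the missing colour `b′`, which `v`
      -- takes. Any colour of layer `i` replaces it: by `separated` the two layers share no colour,
      -- since both lack `b`.
      spare : ∃ λ e → Lacks l swapped (suc i) e × e ≢ b′
      spare with layer-nonempty L (<⇒≤ i<D)
      ... | z , lz = swapped z , lacks , below-absent lz≤ (b-below z lz)
        where
        lz≤ : l z ≤ suc i
        lz≤ = ≤-trans (≤-reflexive lz) (n≤1+n i)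
        lacks : Lacks l swapped (suc i) (swapped z)
        lacks w lw e with separated (col z) b (z , lz , refl) (w , lw , transpose-injective b b′
          (trans (sym (prefixSwap-below {l} {col = col} (≤-reflexive lw)))
            (trans e (prefixSwap-below {l} {col = col} lz≤))))
        ... | inj₁ (s , p , q) = b-below s p q
        ... | inj₂ (s , p , q) = b-in s p q

      recoloured-open : Open recoloured
      recoloured-open j j<D with prefixSwap-notFullBeforeMono {l} {suc i} {b} {b′} (open-col j j<D)
      ... | inj₂ (s , t , ls , lt , ne) = inj₂ (s , t , ls , lt , proj₂ (recolour-grows (near-same ls lt , ne)))
      ... | inj₁ (c , lacks) with j ≟ suc i | spare
      ...   | no j≢ | _ = inj₁ (c , λ w lw e →
                lacks w lw (trans (sym (recoloured-other λ { refl → j≢ (trans (sym lw) lv) })) e))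
      ...   | yes refl | d , lacks-d , d≢b′ = inj₁ (d , lacks′)
        where
        lacks′ : Lacks l recoloured (suc i) d
        lacks′ w lw e with w F.≟ v
        ... | yes _ = d≢b′ (sym e)
        ... | no _ = lacks-d w lw e

      duplicate-better : Better col
      duplicate-better = recoloured , recolour grows L , recoloured-open ,
        edgeCount-< grows u v (λ { (_ , ne) → ne cuv }) (near-same lu lv , differ)
        where
        differ : recoloured u ≢ recoloured v
        differ e = absent (subst (Near (suc i)) (sym lu) (n≤1+n _ , n≤1+n _))
          (trans (sym (recoloured-other u≢v)) (trans e recoloured-v))

    diversify : (∀ i → i < D → Separated col i) → ∀ i → i < D → Diverse col i ⊎ Better col
    diversify _ zero _ = inj₁ λ u v lu lv u≢v _ →
      contradiction (trans (root-unique L lu) (sym (root-unique L lv))) u≢v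
    diversify separated (suc i) i+1<D with covered? col i (suc i) | covered? col (suc i) (2 + i)
    ... | inj₁ cov | _ = inj₁ λ _ _ _ _ _ _ → s≤s z≤n , inj₁ cov
    ... | inj₂ _ | inj₁ cov = inj₁ λ _ _ _ _ _ _ → s≤s z≤n , inj₂ cov
    ... | inj₂ (b , p , q) | inj₂ (b′ , p′ , q′) with F.any? (λ u → F.any? (λ v →
            (l u ≟ suc i) ×-dec ((l v ≟ suc i) ×-dec (¬? (u F.≟ v) ×-dec (col u F.≟ col v)))))
    ...   | no ¬w = inj₁ λ u v lu lv ne e → contradiction (u , v , lu , lv , ne , e) ¬w
    ...   | yes (u , v , lu , lv , ne , e) =
            inj₂ (duplicate-better lu lv ne e i<D (separated i i<D) p q p′ q′)
      where
      i<D : i < D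
      i<D = <-trans ≤-refl i+1<D

    improve : ((∀ i → i < D → Separated col i) × (∀ i → i < D → Diverse col i)) ⊎ Better col
    improve with all-or D (λ i _ → separate i)
    ... | inj₂ better = inj₂ better
    ... | inj₁ sep with all-or D (diversify sep)
    ...   | inj₂ better = inj₂ better
    ...   | inj₁ div = inj₁ (sep , div)

  -- Every improvement raises the edge count, which is at most `n * n`; this is the fuel.
  maximise : ∀ {col} → Layering 0 l col → Open col → ∃ λ col′ → Layering 0 l col′ × Open col′ ×
    (∀ i → i < D → Separated col′ i) × (∀ i → i < D → Diverse col′ i)
  maximise L o = go (n * n) L o (m≤n+m _ _)
    where
    go : ∀ fuel {col} → Layering 0 l col → Open col → n * n ≤ edgeCount col + fuel →
      ∃ λ col′ → Layering 0 l col′ × Open col′ ×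
        (∀ i → i < D → Separated col′ i) × (∀ i → i < D → Diverse col′ i)
    go fuel L o enough with improve L o
    ... | inj₁ (sep , div) = _ , L , o , sep , div
    go zero L o enough | inj₂ (col′ , _ , _ , lt) =
      contradiction (≤-trans enough (≤-reflexive (+-identityʳ _))) (<⇒≱ (<-≤-trans lt (countF-≤ _)))
    go (suc fuel) L o enough | inj₂ (col′ , L′ , o′ , lt) =
      go fuel L′ o′ (≤-trans enough (≤-trans (≤-reflexive (+-suc _ fuel)) (+-monoˡ-≤ fuel lt)))

-- From statements on vertices to the numerical layer conditions.

≡ᵇ-true⇒≡ : ∀ {i j} → (i ≡ᵇ j) ≡ true → i ≡ j
≡ᵇ-true⇒≡ {i} {j} e = ≡ᵇ⇒≡ i j (Equivalence.from T-≡ e)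

≡⇒≡ᵇ-true : ∀ {i j} → i ≡ j → (i ≡ᵇ j) ≡ true
≡⇒≡ᵇ-true {i} {j} e = Equivalence.to T-≡ (≡⇒≡ᵇ i j e)

module Colours {n k : ℕ} (G : Graph n) (col : Fin n → Fin k) where

  usedOn⇒ : ∀ {P a} → usedOn G col P a ≡ true → ∃ λ v → P v ≡ true × col v ≡ a
  usedOn⇒ {a = a} e with anyF⇒ e
  ... | v , p with ∧⇒ p
  ...   | q , r = v , q , ⌊⌋⇒ (col v F.≟ a) r

  ⇒usedOn : ∀ {P a} v → P v ≡ true → col v ≡ a → usedOn G col P a ≡ true
  ⇒usedOn {P} {a} v p e = ⇒anyF v both
    where
    both : P v ∧ ⌊ col v F.≟ a ⌋ ≡ true
    both rewrite p = ⇒⌊⌋ (col v F.≟ a) e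

module Conditions {n k : ℕ} (3≤k : 3 ≤ k) (G : Graph n) (D δ : ℕ) (x : Fin n)
  {l : Fin n → ℕ} {col : Fin n → Fin k} (dist≡l : ∀ v → dist G x v ≡ l v)
  (L : Layers.Rooted.Layering D δ x 0 l col) where
  open Layers {n} {k}
  open Rooted D δ x
  open Layering
  open Colours G col
  open Maximal {n} {k} D δ x l using (Separated; Diverse; Open)
  open Unblocking 3≤k D δ x using (lacks-or-full; full⇒2≤)

  inLayer⇒ : ∀ {j v} → inLayer G x j v ≡ true → l v ≡ j
  inLayer⇒ {v = v} e = trans (sym (dist≡l v)) (≡ᵇ-true⇒≡ e)

  ⇒inLayer : ∀ {j v} → l v ≡ j → inLayer G x j v ≡ true
  ⇒inLayer {v = v} e = ≡⇒≡ᵇ-true (trans (dist≡l v) e)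

  used : ℕ → Fin k → Bool
  used j = usedOn G col (inLayer G x j)

  used⇒ : ∀ {j a} → used j a ≡ true → Has l col j a
  used⇒ e with usedOn⇒ e
  ... | v , p , q = v , inLayer⇒ p , q

  ⇒used : ∀ {j a} → Has l col j a → used j a ≡ true
  ⇒used (v , p , q) = ⇒usedOn v (⇒inLayer p) q

  c : ℕ → ℕ
  c = cLayer G col x

  used₂ : ℕ → Fin k → Bool
  used₂ i = usedOn G col (λ v → inLayer G x i v ∨ inLayer G x (suc i) v)

  used₂⇒ : ∀ {i} a → used₂ i a ≡ true → used i a ≡ true ⊎ used (suc i) a ≡ true
  used₂⇒ {i} a e with usedOn⇒ e
  ... | v , p , q with ∨⇒ {inLayer G x i v} p
  ...   | inj₁ r = inj₁ (⇒usedOn v r q)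
  ...   | inj₂ r = inj₂ (⇒usedOn v r q)

  ⇒used₂ : ∀ {i} a → used i a ≡ true ⊎ used (suc i) a ≡ true → used₂ i a ≡ true
  ⇒used₂ {i} a (inj₁ e) with usedOn⇒ e
  ... | v , p , q = ⇒usedOn v (⇒∨ (inj₁ p)) q
  ⇒used₂ {i} a (inj₂ e) with usedOn⇒ e
  ... | v , p , q = ⇒usedOn v (⇒∨ {inLayer G x i v} (inj₂ p)) q

  covering⇒k≤ : ∀ i j → (∀ b → Has l col i b ⊎ Has l col j b) → k ≤ c i + c j
  covering⇒k≤ i j cov = subst (_≤ c i + c j) (countF-true k)
    (countF-cover λ b _ → [ inj₁ ∘ ⇒used , inj₂ ∘ ⇒used ]′ (cov b))

  -- If layer `suc i` had all colours, a vertex there with the colour of some `z` in layer `i` would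
  -- have a parent of another colour, so layer `i` would have two colours.
  mono⇒<k : ∀ {i} → i < D → c i ≡ 1 → c (suc i) ≤ k ∸ 1
  mono⇒<k {i} i<D ci with lacks-or-full L (suc i)
  ... | inj₁ (a , lacks) = ≤-pred (≤-trans (countF-<-full a absent) (m≤n+m∸n k 1))
    where
    absent : used (suc i) a ≡ false
    absent with used (suc i) a in e
    ... | false = refl
    ... | true = let v , p , q = used⇒ e in contradiction q (lacks v p)
  ... | inj₂ full with layer-nonempty L (<⇒≤ i<D)
  ...   | z , lz with full (col z)
  ...     | v , lv , cv with parent L lv (λ ())
  ...       | u , lu , ne = contradiction (sym ci) (<⇒≢ (countF-two
                (⇒used (u , lu , refl)) (⇒used (z , lz , refl)) (λ e → ne (trans e (sym cv)))))

  shared : ∀ i → (∃ λ a → used i a ≡ true × used (suc i) a ≡ true) ⊎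
    (∀ a → used i a ≡ true → used (suc i) a ≡ true → ⊥)
  shared i with F.any? (λ a → (used i a Bool.≟ true) ×-dec (used (suc i) a Bool.≟ true))
  ... | yes w = inj₁ w
  ... | no ¬w = inj₂ λ a p q → ¬w (a , p , q)

  module _ {i} (separated : Separated col i) where

    shared⇒all : ∀ {a} → used i a ≡ true → used (suc i) a ≡ true →
      ∀ b → used i b ≡ true ⊎ used (suc i) b ≡ true
    shared⇒all p q b = [ inj₁ ∘ ⇒used , inj₂ ∘ ⇒used ]′ (separated _ b (used⇒ p) (used⇒ q))

    -- Either the layers share no colour and the counts add up, or they share one and together have
    -- all `k`.
    twoLayers : cTwoLayers G col x i ≡ k ⊓ (c i + c (suc i))
    twoLayers with shared i
    ... | inj₂ disjoint = trans union (sym (m≥n⇒m⊓n≡n (subst (_≤ k) union (countF-≤ (used₂ i)))))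
      where
      union : cTwoLayers G col x i ≡ c i + c (suc i)
      union = ≤-antisym (countF-cover used₂⇒)
        (countF-disjoint disjoint (λ a → ⇒used₂ a ∘ inj₁) (λ a → ⇒used₂ a ∘ inj₂))
    ... | inj₁ (a , p , q) = trans all (sym (m≤n⇒m⊓n≡m (subst (_≤ c i + c (suc i)) all (countF-cover used₂⇒))))
      where
      all : cTwoLayers G col x i ≡ k
      all = countF-all λ b → ⇒used₂ b (shared⇒all p q b)

    -- With a shared `a` the layers have all `k` colours even when `a` is dropped from the second,
    -- so their counts sum to more than `k`.
    unshared : c i + c (suc i) ≤ k → ∀ a → used i a ≡ true → used (suc i) a ≡ false
    unshared ≤k a p with used (suc i) a in q
    ... | false = refl
    ... | true = contradiction ≤k (<⇒≱ (≤-<-trans k≤ (+-monoʳ-< (c i) (countF-without _ a q))))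
      where
      k≤ : k ≤ c i + countF (without (used (suc i)) a)
      k≤ = subst (_≤ c i + countF (without (used (suc i)) a)) (countF-true k) (countF-cover cover)
        where
        cover : ∀ b → true ≡ true → used i b ≡ true ⊎ without (used (suc i)) a b ≡ true
        cover b _ = go (b F.≟ a) (shared⇒all p q b)
          where
          go : Dec (b ≡ a) → used i b ≡ true ⊎ used (suc i) b ≡ true →
            used i b ≡ true ⊎ without (used (suc i)) a b ≡ true
          go (yes refl) _ = inj₁ p
          go (no _) (inj₁ r) = inj₁ r
          go (no ne) (inj₂ r) = inj₂ (without-≢ (used (suc i)) a b r ne)

  full-layer : ∀ {i} → NotFullBeforeMono l col i → c i ≡ k → 2 ≤ i × 2 ≤ c (suc i)
  full-layer {i} notFull ci = full⇒2≤ L i full , two notFull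
    where
    full : ∀ a → Has l col i a
    full a = used⇒ (countF-full ci a)
    two : NotFullBeforeMono l col i → 2 ≤ c (suc i)
    two (inj₁ (a , lacks)) = let v , p , q = full a in contradiction q (lacks v p)
    two (inj₂ (u , v , lu , lv , ne)) = countF-two (⇒used (u , lu , refl)) (⇒used (v , lv , refl)) ne

  repeated : ∀ {i} → Diverse col i → c i < layerSize G x i →
    0 < i × k ≤ c i + (c (i ∸ 1) ⊔ c (suc i))
  repeated {i} diverse lt with F.any? (λ u → F.any? (λ v →
      (l u ≟ i) ×-dec ((l v ≟ i) ×-dec (¬? (u F.≟ v) ×-dec (col u F.≟ col v)))))
  -- Without a repetition the colouring is injective on the layer, which then has at least as many
  -- colours as vertices.
  ... | no ¬w = contradiction lt (≤⇒≯ (countF-image _ _ col injective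
          (λ v p → ⇒usedOn v p refl)))
    where
    injective : ∀ {u v} → inLayer G x i u ≡ true → inLayer G x i v ≡ true → col u ≡ col v → u ≡ v
    injective {u} {v} p q e with u F.≟ v
    ... | yes r = r
    ... | no ne = contradiction (u , v , inLayer⇒ p , inLayer⇒ q , ne , e) ¬w
  ... | yes (u , v , lu , lv , ne , e) with diverse u v lu lv ne e
  ...   | i>0 , inj₁ cov = i>0 , ≤-trans (covering⇒k≤ (i ∸ 1) i cov)
            (≤-trans (≤-reflexive (+-comm (c (i ∸ 1)) (c i))) (+-monoʳ-≤ (c i) (m≤m⊔n _ _)))
  ...   | i>0 , inj₂ cov = i>0 , ≤-trans (covering⇒k≤ i (suc i) cov)
            (+-monoʳ-≤ (c i) (m≤n⊔m (c (i ∸ 1)) _))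

  layerConditions : Open col → (∀ i → i < D → Separated col i) → (∀ i → i < D → Diverse col i) →
    LayerConditions G k col x D
  layerConditions o s d i i<D =
    mono⇒<k i<D , twoLayers (s i i<D) , unshared (s i i<D) , full-layer (o i i<D) , repeated (d i i<D)

  ecc≡D : eccentricity G x ≡ D
  ecc≡D = ≤-antisym
    (maxF-least (dist G x) λ v → subst (_≤ D) (sym (dist≡l v)) (bound L v))
    (let t , lt = top L in subst (_≤ eccentricity G x) (trans (dist≡l t) lt) (maxF-upper (dist G x) t))

  -- Only `i = 0` occurs. Layer 0 is the root alone: it is not full, repeats no colour, and is the
  -- parent of every vertex of layer 1, so shares no colour with it.
  shallow : D ≤ 1 → LayerConditions G k col x D
  shallow D≤1 = layerConditions
    (λ i i<D → case i<1 i<D of λ { refl → open₀ (lacks-or-full L 0) })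
    (λ i i<D → case i<1 i<D of λ { refl → separated₀ })
    (λ i i<D → case i<1 i<D of λ { refl → λ u v lu lv ne _ →
      contradiction (trans (root-unique L lu) (sym (root-unique L lv))) ne })
    where
    i<1 : ∀ {i} → i < D → i ≡ 0
    i<1 i<D = n<1⇒n≡0 (<-≤-trans i<D D≤1)
    open₀ : ∃ (Lacks l col 0) ⊎ (∀ a → Has l col 0 a) → NotFullBeforeMono l col 0
    open₀ (inj₁ w) = inj₁ w
    open₀ (inj₂ full) = contradiction (full⇒2≤ L 0 full) λ ()
    separated₀ : Separated col 0
    separated₀ a b (u , lu , cu) (v , lv , cv) with parent L lv (λ ())
    ... | w , lw , ne with refl ← root-unique L lu | refl ← root-unique L lw =
      contradiction (trans cu (sym cv)) ne

-- The saturated graph of a layering: its distances and diameter.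

module Saturated {n k : ℕ} (D δ : ℕ) (x : Fin n) {l : Fin n → ℕ} {col : Fin n → Fin k}
  (L : Layers.Rooted.Layering D δ x 0 l col) where
  open Layers {n} {k}
  open Rooted D δ x
  open Layering

  saturated : Graph n
  saturated = record
    { adj = λ u v → ⌊ edge? l col u v ⌋
    ; sym = λ u v → ⌊⌋-cong (edge? l col u v) (edge? l col v u)
                        (edge-sym {l} {col} {u}) (edge-sym {l} {col} {v})
    ; irrefl = λ v → ¬⇒⌊⌋ (edge? l col v v) λ { (_ , ne) → ne refl }
    }

  adjacent : ∀ {u v} → Edge l col u v → adj saturated u v ≡ true
  adjacent {u} {v} = ⇒⌊⌋ (edge? l col u v)

  adjacent⇒ : ∀ {u v} → adj saturated u v ≡ true → Edge l col u v
  adjacent⇒ {u} {v} = ⌊⌋⇒ (edge? l col u v)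

  proper : ProperColoring saturated k col
  proper u v = proj₂ ∘ adjacent⇒

  reaches : ℕ → Fin n → Fin n → Set
  reaches j u v = reach saturated j u v ≡ true

  reach-root : ∀ j {v} → l v ≡ j → reaches j x v
  reach-root zero lv with refl ← root-unique L lv = reach-refl saturated
  reach-root (suc j) lv with parent L lv (λ ())
  ... | u , lu , ne = reach-step saturated {j} (reach-root j lu) (adjacent (near-suc lu lv , ne))

  layer-≤ : ∀ j {v} → reaches j x v → l v ≤ j
  layer-≤ zero {v} r with refl ← ⌊⌋⇒ (x F.≟ v) r = ≤-reflexive (root L)
  layer-≤ (suc j) {v} r with reach-suc⇒ saturated {j} r
  ... | inj₁ p = ≤-trans (layer-≤ j p) (n≤1+n j)
  ... | inj₂ (w , p , a) = ≤-trans (proj₂ (proj₁ (adjacent⇒ a))) (s≤s (layer-≤ j p))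

  dist≡l : ∀ v → dist saturated x v ≡ l v
  dist≡l v = isDistance⇒dist saturated (reach-root (l v) refl , below)
    where
    below : ∀ j → j < l v → reach saturated j x v ≡ false
    below j j<l with reach saturated j x v in e
    ... | false = refl
    ... | true = contradiction (layer-≤ j e) (<⇒≱ j<l)

  reach-edge : ∀ {u v} → Edge l col u v → reaches 2 u v
  reach-edge {u} {v} e = reach-weaken saturated {1} {2} (s≤s z≤n)
    (reach-step saturated {0} (reach-refl saturated) (adjacent e))

  reach-path : ∀ {u w v} → Edge l col u w → Edge l col w v → reaches 2 u v
  reach-path e f = reach-step saturated {1}
    (reach-step saturated {0} (reach-refl saturated) (adjacent e)) (adjacent f)

  -- If the colours agree, a parent of `u` differs in colour from `v` too and is a common neighbour.
  reach-same : ∀ {u v j} → l u ≡ suc j → l v ≡ suc j → reaches 2 u v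
  reach-same {u} {v} lu lv with col u F.≟ col v
  ... | no ne = reach-edge (near-same lu lv , ne)
  ... | yes e with parent L lu (λ ())
  ...   | p , lp , ne = reach-path (near-sym (near-suc lp lu) , ne ∘ sym)
            (near-suc lp lv , λ f → ne (trans f (sym e)))

  -- Descending from `v` through parents costs one step per layer. An extra step arises only at the
  -- end, when `u` has the colour of the vertex reached just above it: a parent of that vertex in
  -- the layer of `u` is joined to both.
  reach-higher : ∀ g {u v} → l v ≡ suc g + l u → reaches (2 + g) u v
  reach-higher (suc g) lv with parent L lv (λ ())
  ... | p , lp , ne = reach-step saturated {2 + g} (reach-higher g lp) (adjacent (near-suc lp lv , ne))
  reach-higher zero {u} {v} lv with col u F.≟ col v
  ... | no ne = reach-edge (near-suc refl lv , ne)
  ... | yes e with parent L lv (λ ())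
  ...   | p , lp , ne = reach-path (near-same refl lp , λ f → ne (trans (sym f) e)) (near-suc lp lv , ne)

  -- From u ≠ x at most one step is lost on the way to a farther layer, and layer 1 to layer D
  -- leaves room for it.
  reach-upward : 2 ≤ D → ∀ {u v} → l u ≤ l v → reaches D u v
  reach-upward 2≤D {u} {v} le with l u in lu
  ... | zero with refl ← root-unique L lu =
    reach-weaken saturated (bound L v) (reach-root (l v) refl)
  ... | suc j with m≤n⇒m<n∨m≡n le
  ...   | inj₂ e = reach-weaken saturated 2≤D (reach-same lu (sym e))
  ...   | inj₁ lt with m≤n⇒∃[o]m+o≡n lt
  ...     | g , e = reach-weaken saturated g+2≤D (reach-higher g lv)
    where
    lv : l v ≡ suc g + l u
    lv = trans (sym e) (trans (cong suc (+-comm (suc j) g)) (cong (suc g +_) (sym lu)))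
    g+2≤D : 2 + g ≤ D
    g+2≤D = ≤-trans (≤-trans (s≤s (s≤s (m≤n+m g j))) (≤-reflexive e)) (bound L v)

  reach-D : 2 ≤ D → ∀ u v → reaches D u v
  reach-D 2≤D u v with ≤-total (l u) (l v)
  ... | inj₁ le = reach-upward 2≤D le
  ... | inj₂ ge = reach-sym saturated D (reach-upward 2≤D ge)

  diameter-≤ : 2 ≤ D → diameter saturated ≤ D
  diameter-≤ 2≤D = maxF-least (eccentricity saturated) λ u →
    maxF-least (dist saturated u) λ v → dist-≤ saturated (reach-D 2≤D u v)

-- The distance layers of the given graph, and the final construction.

module Geodesic {n k : ℕ} (D δ : ℕ) (x : Fin n) (G : Graph n) (conn : Connected G)
  (col : Fin n → Fin k) (proper : ProperColoring G k col) (mindeg : MinDegreeAtLeast G δ)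
  (ecc : eccentricity G x ≡ D) (far : ∃ λ v → dist G x v ≡ eccentricity G x) where
  open Layers {n} {k}
  open Rooted D δ x

  isDist : ∀ v → IsDistance G x v (dist G x v)
  isDist = dist-isDistance conn x

  near-adjacent : ∀ {u v} → adj G u v ≡ true → dist G x v ≤ suc (dist G x u)
  near-adjacent {u} a = dist-≤ G (reach-step G {dist G x u} (proj₁ (isDist u)) a)

  -- The given graph is a subgraph of the saturated graph of its distance layers, so its degree
  -- bound carries over.
  edge : ∀ {u v} → adj G u v ≡ true → Edge (dist G x) col u v
  edge {u} {v} a = (near-adjacent (trans (Graph.sym G v u) a) , near-adjacent a) , proper u v a

  geodesic-layering : Layering 0 (dist G x) col
  geodesic-layering = record
    { root = isDistance⇒dist G (reach-refl G , λ _ ())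
    ; root-unique = λ {v} e → sym (⌊⌋⇒ (x F.≟ v) (subst (λ d → reach G d x v ≡ true) e (proj₁ (isDist v))))
    ; top = proj₁ far , trans (proj₂ far) ecc
    ; bound = λ v → subst (dist G x v ≤_) ecc (maxF-upper (dist G x) v)
    ; parent = parent′
    ; degree-≥ = λ v → ≤-trans (mindeg v) (countF-mono λ u → ⇒⌊⌋ (edge? (dist G x) col v u) ∘ edge)
    }
    where
    parent′ : ∀ {v j} → dist G x v ≡ suc j → suc j ≢ 0 → ∃ λ u → dist G x u ≡ j × col u ≢ col v
    parent′ {v} e _ with isDistance-pred G (subst (IsDistance G x v) e (isDist v))
    ... | w , dw , a = w , isDistance⇒dist G dw , proper w v a

theorem4p1 : (k n D δ : ℕ) → 3 ≤ k → 0 < n → (G′ : Graph n) →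
    Colorable G′ k → Connected G′ → diameter G′ ≡ D → MinDegreeAtLeast G′ δ →
    Σ (Graph n) λ G → Connected G × diameter G ≡ D × MinDegreeAtLeast G δ ×
    Σ (Fin n → Fin k) λ col → ProperColoring G k col ×
    Σ (Fin n) λ x → eccentricity G x ≡ D × LayerConditions G k col x D
theorem4p1 k (suc n) D δ 3≤k _ G′ (col , proper) conn diam mindeg with maxF-attained (eccentricity G′)
... | x , ecc with D ≤? 1
...   | yes D≤1 = G′ , conn , diam , mindeg , col , proper , x , trans ecc diam ,
        Conditions.shallow 3≤k G′ D δ x (λ _ → refl) L D≤1
  where
  L = Geodesic.geodesic-layering D δ x G′ conn col proper mindeg (trans ecc diam)
        (maxF-attained (dist G′ x))
...   | no D≰1 with Unblocking.unblock-all 3≤k D δ x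
          (Geodesic.geodesic-layering D δ x G′ conn col proper mindeg (trans ecc diam)
            (maxF-attained (dist G′ x)))
-- The layers are final at this point; maximisation changes only the colouring.
...     | l , col₁ , L₁ , open₁ with Maximal.maximise D δ x l L₁ open₁
...       | col₂ , L , open₂ , separated , diverse =
        saturated , (λ u v → D , reach-D 2≤D u v) , ≤-antisym (diameter-≤ 2≤D) D≤diameter ,
        Layers.Rooted.Layering.degree-≥ L , col₂ , Saturated.proper D δ x L , x , ecc≡D ,
        layerConditions open₂ separated diverse
  where
  open Saturated D δ x L hiding (proper)
  open Conditions 3≤k saturated D δ x dist≡l L
  2≤D : 2 ≤ D
  2≤D = ≰⇒> D≰1
  D≤diameter : D ≤ diameter saturated
  D≤diameter = subst (_≤ diameter saturated) ecc≡D (maxF-upper (eccentricity saturated) x)
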